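{- For every integer $n\geq 1$, $\log\log e_n \geq n-\log n-1$; moreover, as $n\to\infty$, $\log\log e_n \leq n-\log n+O(\log\log n)$.
   Context: All logarithms are to base two. A delta-matroid $(E,\mathcal F)$ consists of a finite set $E$ and a non-empty collection $\mathcal F$ of subsets of $E$ (the feasible sets) satisfying the symmetric exchange axiom: for all $X,Y\in\mathcal F$ and every $e\in X\bigtriangleup Y$ there exists $f\in X\bigtriangleup Y$ (possibly $f=e$) with $X\bigtriangleup\{e,f\}\in\mathcal F$. A delta-matroid is even if all its feasible sets have sizes of the same parity. Let $e_n$ denote the number of even delta-matroids with ground set $[n]=\{1,\dots,n\}$. -}

module Defs where

open import Data.Bool using (Bool; _xor_)
open import Data.Bool.Properties using () renaming (_≟_ to _≟ᵇ_)
open import Data.Nat using (ℕ; zero; suc; _%_)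
open import Data.Nat.Properties using () renaming (_≟_ to _≟ℕ_)
open import Data.Fin using (Fin)
open import Data.Fin.Properties using (all?; any?)
open import Data.Fin.Subset using (Subset; inside; outside; _∈_; _∪_; ⁅_⁆; ∣_∣)
open import Data.Fin.Subset.Properties using (_∈?_)
open import Data.Vec using (Vec; []; _∷_; zipWith)
open import Data.Vec.Properties using (≡-dec)
open import Data.List using (List; []; _∷_; _++_; map; filter; length)
open import Data.List.Relation.Unary.All as All using (All)
open import Data.Product using (Σ; ∃-syntax; _×_; _,_)
open import Relation.Binary.PropositionalEquality using (_≡_; _≢_)
open import Relation.Nullary using (Dec; yes; no; ¬?)
open import Relation.Nullary.Decidable using (_×-dec_; _→-dec_)
import Data.List.Membership.DecPropositional as DecMem

_△_ : ∀ {n} → Subset n → Subset n → Subset n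
_△_ = zipWith _xor_

_≟ˢ_ : ∀ {n} (X Y : Subset n) → Dec (X ≡ Y)
_≟ˢ_ = ≡-dec _≟ᵇ_

Family : ℕ → Set
Family n = List (Subset n)

module _ {n : ℕ} where
  open DecMem (_≟ˢ_ {n}) using () renaming (_∈_ to _∈ᶠ_; _∈?_ to _∈ᶠ?_)

  SymmetricExchange : Family n → Set
  SymmetricExchange F =
    All (λ X → All (λ Y →
      ∀ (e : Fin n) → e ∈ (X △ Y) →
        ∃[ f ] (f ∈ (X △ Y) × (X △ (⁅ e ⁆ ∪ ⁅ f ⁆)) ∈ᶠ F)) F) F

  IsDeltaMatroid : Family n → Set
  IsDeltaMatroid F = (F ≢ []) × SymmetricExchange F

  AllSameParity : Family n → Set
  AllSameParity F = All (λ X → All (λ Y → ∣ X ∣ % 2 ≡ ∣ Y ∣ % 2) F) F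

  IsEvenDeltaMatroid : Family n → Set
  IsEvenDeltaMatroid F = IsDeltaMatroid F × AllSameParity F

  nonEmpty? : (F : Family n) → Dec (F ≢ [])
  nonEmpty? [] = no (λ p → p _≡_.refl)
  nonEmpty? (x ∷ F) = yes (λ ())

  symmetricExchange? : (F : Family n) → Dec (SymmetricExchange F)
  symmetricExchange? F =
    All.all? (λ X → All.all? (λ Y →
      all? (λ e → (e ∈? (X △ Y)) →-dec
        any? (λ f → (f ∈? (X △ Y)) ×-dec ((X △ (⁅ e ⁆ ∪ ⁅ f ⁆)) ∈ᶠ? F)))) F) F

  allSameParity? : (F : Family n) → Dec (AllSameParity F)
  allSameParity? F = All.all? (λ X → All.all? (λ Y → (∣ X ∣ % 2) ≟ℕ (∣ Y ∣ % 2)) F) F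

  isEvenDeltaMatroid? : (F : Family n) → Dec (IsEvenDeltaMatroid F)
  isEvenDeltaMatroid? F = (nonEmpty? F ×-dec symmetricExchange? F) ×-dec allSameParity? F

allSubsets : (n : ℕ) → List (Subset n)
allSubsets zero = [] ∷ []
allSubsets (suc n) = map (outside ∷_) (allSubsets n) ++ map (inside ∷_) (allSubsets n)

-- All sublists (order-preserving) of a list: for a duplicate-free list these
-- are exactly its subsets, each represented once.
sublists : ∀ {A : Set} → List A → List (List A)
sublists [] = [] ∷ []
sublists (x ∷ xs) = sublists xs ++ map (x ∷_) (sublists xs)

e : ℕ → ℕ
e n = length (filter isEvenDeltaMatroid? (sublists (allSubsets n)))

{-# OPTIONS --safe #-}
module Submission where

-- Lower bound.  Let the elements 0, …, n − 1 carry their index as weight.  The even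
-- sets fall into n classes by total weight mod n.  Deleting any part of one class
-- from the family of all even sets leaves an even delta-matroid, so a class of size
-- at least 2 ^ (n − 1) / n gives the bound.
--
-- Upper bound.  For an infeasible set X of an even delta-matroid, the pairs {a , b}
-- with X △ {a , b} feasible form a complete multipartite graph up to isolated
-- vertices, so (n + 1) ^ n labellings describe all sets at distance two from X.  In a
-- family of density α ≥ c / n in the cube some member has about α n² / 2 members at
-- distance two (double counting and Cauchy–Schwarz), so a greedy choice of
-- O(2 ^ n log n / n²) infeasible sets describes all infeasible sets except
-- O(2 ^ n / n) of them, which are listed.

open import Defs
open import Data.Bool using (Bool; true; false; not; T; _∧_; _xor_; if_then_else_)
open import Data.Bool.Properties using (not-involutive; not-injective; not-¬; ∧-conicalˡ; ∧-conicalʳ; xor-same; xor-comm; xor-identityʳ; xor-annihilates-not; not-distribˡ-xor; not-distribʳ-xor) renaming (_≟_ to _≟ᵇ_)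
open import Data.Empty using (⊥-elim)
import Data.Empty as Empty
open import Data.Nat using (ℕ; zero; suc; _+_; _*_; _∸_; _^_; _/_; _%_; _≤_; _<_; _≡ᵇ_; _≤?_; z≤n; s≤s; NonZero; >-nonZero; >-nonZero⁻¹; ⌈_/2⌉; ⌊_/2⌋)
open import Data.Nat.Properties
open import Data.Nat.DivMod using (m*n/n≡m; m/n*n≤m; /-monoˡ-≤; m≡m%n+[m/n]*n; [m+n]%n≡m%n; [m+kn]%n≡m%n; m<n⇒m%n≡m; m%n<n)
open import Data.Nat.Induction using (<-rec)
open import Data.Nat.Logarithm using (⌈log₂_⌉; ⌈log₂⌉-mono-≤; ⌈log₂⌈n/2⌉⌉≡⌈log₂n⌉∸1; ⌈log₂2^n⌉≡n)
open import Data.Nat.Tactic.RingSolver using (solve-∀)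
open import Data.Fin using (Fin; zero; suc; toℕ)
open import Data.Fin.Properties using (any?; toℕ-injective; toℕ<n) renaming (_≟_ to _≟ᶠ_)
open import Data.Fin.Subset as Subset using (Subset; inside; outside; _∪_; ⁅_⁆; ∣_∣; ⊥)
open import Data.Fin.Subset.Properties using (anySubset?; ∪-identityˡ; ∪-identityʳ; ∣⊥∣≡0)
open import Data.Maybe as Maybe using (Maybe; just; nothing)
import Data.Maybe.Properties as Maybe
open import Data.Vec as Vec using (Vec; []; _∷_; updateAt; lookup; tabulate)
open import Data.Vec.Properties as Vec using (updateAt-updateAt; updateAt-id; updateAt-cong; updateAt-commutes; lookup∘updateAt; lookup∘updateAt′; lookup-zipWith; lookup∘tabulate; zipWith-identityʳ; []=⇒lookup; lookup⇒[]=)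
open import Data.List using (List; []; _∷_; _++_; map; filter; length; removeAt; cartesianProductWith; cartesianProduct; allFin)
open import Data.List.Properties as List using (length-++; length-map; length-removeAt′; length-tabulate; filter-++; filter-accept; filter-reject)
open import Data.List.Membership.Propositional using (_∈_)
open import Data.List.Membership.Propositional.Properties using (∈-++⁺ˡ; ∈-++⁺ʳ; ∈-++⁻; ∈-map⁺; ∈-map⁻; ∈-filter⁺; ∈-filter⁻; ∈-cartesianProductWith⁺; ∈-allFin)
import Data.List.Membership.DecPropositional as DecMembership
open import Data.List.Relation.Unary.All as All using (All; []; _∷_)
import Data.List.Relation.Unary.All.Properties as All
open import Data.List.Relation.Unary.AllPairs using ([]; _∷_)
open import Data.List.Relation.Unary.Any as Any using (Any; here; there)
import Data.List.Relation.Unary.Any.Properties as Any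
open import Data.List.Relation.Unary.Unique.Propositional using (Unique)
import Data.List.Relation.Unary.Unique.Propositional.Properties as Unique
open import Algebra.Properties.CommutativeMonoid.Sum +-0-commutativeMonoid using (sum; ∑-distrib-+; sum-replicate-zero)
open import Data.Product using (∃-syntax; _×_; _,_; proj₁; proj₂)
open import Data.Sum using (_⊎_; inj₁; inj₂)
open import Function using (_∘_; case_of_)
open import Relation.Binary.PropositionalEquality using (_≡_; _≢_; refl; sym; trans; cong; cong₂; subst; ≢-sym; module ≡-Reasoning)
open import Relation.Nullary using (Dec; yes; no; ¬_; ¬?; contradiction)
open import Relation.Nullary.Decidable using (does; dec-true; _×-dec_; _⊎-dec_)
open import Relation.Unary using (Decidable)

-- Double counting in the cube

-- Both bounds concern `e n ^ n`, that is n log e_n: the exponents lose their denominator n,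
-- everything stays in ℕ, and two logarithms give back the term - log n. The obstacle in the upper
-- bound is the number of greedy centres. A centre costs about n log n bits. A single threshold that
-- still works at density about 1 / n guarantees only order n new sets per centre, hence order 2 ^ n
-- / n centres, which is too many. The choice therefore runs in rounds that halve the density: when
-- at most 2 ^ n / M sets remain, each centre must remove n² / (8 M) of them, so a round takes at
-- most 8 · 2 ^ n / n² centres whatever M is. About log n rounds cost O(2 ^ n (log n)² / n) bits.
-- Below density of order 1 / n the second moment is dominated by its diagonal term (a set paired
-- with itself) and gives no pairs at distance two. The O(2 ^ n / n) sets left at that point are
-- cheap to list, at O(log n) bits each.

flip : ∀ {n} → Fin n → Subset n → Subset n
flip i X = updateAt X i not

cubeSum : ∀ {n} → (Subset n → ℕ) → ℕ
cubeSum {zero}  g = g []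
cubeSum {suc n} g = cubeSum (g ∘ (false ∷_)) + cubeSum (g ∘ (true ∷_))

cubeSum-cong : ∀ {n} {g h : Subset n → ℕ} → (∀ X → g X ≡ h X) → cubeSum g ≡ cubeSum h
cubeSum-cong {zero}  eq = eq []
cubeSum-cong {suc n} eq = cong₂ _+_ (cubeSum-cong (eq ∘ (false ∷_))) (cubeSum-cong (eq ∘ (true ∷_)))

cubeSum-mono : ∀ {n} {g h : Subset n → ℕ} → (∀ X → g X ≤ h X) → cubeSum g ≤ cubeSum h
cubeSum-mono {zero}  le = le []
cubeSum-mono {suc n} le = +-mono-≤ (cubeSum-mono (le ∘ (false ∷_))) (cubeSum-mono (le ∘ (true ∷_)))

cubeSum-distrib-+ : ∀ {n} (g h : Subset n → ℕ) → cubeSum (λ X → g X + h X) ≡ cubeSum g + cubeSum h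
cubeSum-distrib-+ {zero}  g h = refl
cubeSum-distrib-+ {suc n} g h =
  trans (cong₂ _+_ (cubeSum-distrib-+ (g ∘ (false ∷_)) _) (cubeSum-distrib-+ (g ∘ (true ∷_)) _))
    (interchange (cubeSum (g ∘ (false ∷_))) (cubeSum (h ∘ (false ∷_))) _ _)
  where
  interchange : ∀ a b c d → (a + b) + (c + d) ≡ (a + c) + (b + d)
  interchange = solve-∀

cubeSum-distribʳ-* : ∀ {n} (g : Subset n → ℕ) c → cubeSum (λ X → g X * c) ≡ cubeSum g * c
cubeSum-distribʳ-* {zero}  g c = refl
cubeSum-distribʳ-* {suc n} g c =
  trans (cong₂ _+_ (cubeSum-distribʳ-* (g ∘ (false ∷_)) c) (cubeSum-distribʳ-* (g ∘ (true ∷_)) c))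
        (sym (*-distribʳ-+ c (cubeSum (g ∘ (false ∷_))) _))

cubeSum-1 : ∀ n → cubeSum {n} (λ _ → 1) ≡ 2 ^ n
cubeSum-1 zero    = refl
cubeSum-1 (suc n) = cong₂ _+_ (cubeSum-1 n) (trans (cubeSum-1 n) (sym (+-identityʳ _)))

sq-sum-≤ : ∀ a b → (a + b) * (a + b) ≤ 2 * (a * a + b * b)
sq-sum-≤ a b with ≤-total a b
... | inj₁ a≤b = let c , eq = m≤n⇒∃[o]m+o≡n a≤b in lemma a c b eq
  where
  identity : ∀ a c → 2 * (a * a + (a + c) * (a + c)) ≡ (a + (a + c)) * (a + (a + c)) + c * c
  identity = solve-∀
  lemma : ∀ a c b → a + c ≡ b → (a + b) * (a + b) ≤ 2 * (a * a + b * b)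
  lemma a c _ refl = ≤-trans (m≤m+n _ (c * c)) (≤-reflexive (sym (identity a c)))
... | inj₂ b≤a = let c , eq = m≤n⇒∃[o]m+o≡n b≤a in lemma b c a eq
  where
  identity : ∀ b c → 2 * ((b + c) * (b + c) + b * b) ≡ ((b + c) + b) * ((b + c) + b) + c * c
  identity = solve-∀
  lemma : ∀ b c a → b + c ≡ a → (a + b) * (a + b) ≤ 2 * (a * a + b * b)
  lemma b c _ refl = ≤-trans (m≤m+n _ (c * c)) (≤-reflexive (sym (identity b c)))

-- Induction on the dimension: (a + b)² ≤ 2 (a² + b²) joins the two half cubes and supplies the new
-- factor 2.
cubeSum-Cauchy-Schwarz : ∀ {n} (g : Subset n → ℕ) → cubeSum g * cubeSum g ≤ 2 ^ n * cubeSum (λ X → g X * g X)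
cubeSum-Cauchy-Schwarz {zero}  g = ≤-reflexive (sym (*-identityˡ _))
cubeSum-Cauchy-Schwarz {suc n} g = begin
  (s₀ + s₁) * (s₀ + s₁)      ≤⟨ sq-sum-≤ s₀ s₁ ⟩
  2 * (s₀ * s₀ + s₁ * s₁)    ≤⟨ *-monoʳ-≤ 2 (+-mono-≤ (cubeSum-Cauchy-Schwarz g₀) (cubeSum-Cauchy-Schwarz g₁)) ⟩
  2 * (2 ^ n * q₀ + 2 ^ n * q₁) ≡⟨ factor (2 ^ n) q₀ q₁ ⟩
  2 * 2 ^ n * (q₀ + q₁)      ∎
  where
  open ≤-Reasoning
  g₀ g₁ : Subset n → ℕ
  g₀ = g ∘ (false ∷_)
  g₁ = g ∘ (true ∷_)
  s₀ s₁ q₀ q₁ : ℕ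
  s₀ = cubeSum g₀
  s₁ = cubeSum g₁
  q₀ = cubeSum (λ X → g₀ X * g₀ X)
  q₁ = cubeSum (λ X → g₁ X * g₁ X)
  factor : ∀ m a b → 2 * (m * a + m * b) ≡ 2 * m * (a + b)
  factor = solve-∀

-- The Hamming sphere of radius r about X, split by whether the first coordinate differs. The
-- recursion parallels `cubeSum`, so the counting identities become inductions on the dimension.
sphereSum : ∀ {n} → ℕ → Subset n → (Subset n → ℕ) → ℕ
sphereSum zero    X       g = g X
sphereSum (suc r) []      g = 0
sphereSum (suc r) (x ∷ X) g = sphereSum r X (g ∘ (not x ∷_)) + sphereSum (suc r) X (g ∘ (x ∷_))

cubeSum-sphereSum-1 : ∀ {n} (g : Subset n → ℕ) → cubeSum (λ X → sphereSum 1 X g) ≡ n * cubeSum g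
cubeSum-sphereSum-1 {zero}  g = refl
cubeSum-sphereSum-1 {suc n} g = begin
  cubeSum (λ X → g₁ X + sphereSum 1 X g₀) + cubeSum (λ X → g₀ X + sphereSum 1 X g₁)
    ≡⟨ cong₂ _+_ (cubeSum-distrib-+ g₁ _) (cubeSum-distrib-+ g₀ _) ⟩
  (cubeSum g₁ + cubeSum (λ X → sphereSum 1 X g₀)) + (cubeSum g₀ + cubeSum (λ X → sphereSum 1 X g₁))
    ≡⟨ cong₂ (λ a b → (cubeSum g₁ + a) + (cubeSum g₀ + b)) (cubeSum-sphereSum-1 g₀) (cubeSum-sphereSum-1 g₁) ⟩
  (cubeSum g₁ + n * cubeSum g₀) + (cubeSum g₀ + n * cubeSum g₁)
    ≡⟨ rearrange n (cubeSum g₀) (cubeSum g₁) ⟩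
  suc n * (cubeSum g₀ + cubeSum g₁) ∎
  where
  open ≡-Reasoning
  g₀ g₁ : Subset n → ℕ
  g₀ = g ∘ (false ∷_)
  g₁ = g ∘ (true ∷_)
  rearrange : ∀ n a b → (b + n * a) + (a + n * b) ≡ suc n * (a + b)
  rearrange = solve-∀

-- Counting pairs of points through a common neighbour: two points at distance
-- two have exactly two common neighbours.
cubeSum-sphereSum-1² : ∀ {n} (g : Subset n → ℕ) →
  cubeSum (λ X → sphereSum 1 X g * sphereSum 1 X g)
    ≡ n * cubeSum (λ X → g X * g X) + 2 * cubeSum (λ X → g X * sphereSum 2 X g)
cubeSum-sphereSum-1² {zero}  g = sym (cong (2 *_) (*-comm (g []) 0))
cubeSum-sphereSum-1² {suc n} g = begin
  cubeSum (λ X → (g₁ X + t₀ X) * (g₁ X + t₀ X)) + cubeSum (λ X → (g₀ X + t₁ X) * (g₀ X + t₁ X))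
    ≡⟨ cong₂ _+_ (square g₁ t₀) (square g₀ t₁) ⟩
  (G₁ + cubeSum (λ X → t₀ X * t₀ X) + C₁₀ * 2) + (G₀ + cubeSum (λ X → t₁ X * t₁ X) + C₀₁ * 2)
    ≡⟨ cong₂ (λ a b → (G₁ + a + C₁₀ * 2) + (G₀ + b + C₀₁ * 2)) (cubeSum-sphereSum-1² g₀) (cubeSum-sphereSum-1² g₁) ⟩
  (G₁ + (n * G₀ + 2 * S₀) + C₁₀ * 2) + (G₀ + (n * G₁ + 2 * S₁) + C₀₁ * 2)
    ≡⟨ rearrange n G₀ G₁ S₀ S₁ C₁₀ C₀₁ ⟩
  suc n * (G₀ + G₁) + 2 * ((C₀₁ + S₀) + (C₁₀ + S₁))
    ≡⟨ cong (λ a → suc n * (G₀ + G₁) + 2 * a) (cong₂ _+_ (distrib g₀ t₁ _) (distrib g₁ t₀ _)) ⟨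
  suc n * (G₀ + G₁) + 2 * (cubeSum (λ X → g₀ X * (t₁ X + sphereSum 2 X g₀)) + cubeSum (λ X → g₁ X * (t₀ X + sphereSum 2 X g₁))) ∎
  where
  open ≡-Reasoning
  g₀ g₁ t₀ t₁ : Subset n → ℕ
  g₀ = g ∘ (false ∷_)
  g₁ = g ∘ (true ∷_)
  t₀ X = sphereSum 1 X g₀
  t₁ X = sphereSum 1 X g₁
  G₀ G₁ S₀ S₁ C₀₁ C₁₀ : ℕ
  G₀ = cubeSum (λ X → g₀ X * g₀ X)
  G₁ = cubeSum (λ X → g₁ X * g₁ X)
  S₀ = cubeSum (λ X → g₀ X * sphereSum 2 X g₀)
  S₁ = cubeSum (λ X → g₁ X * sphereSum 2 X g₁)
  C₀₁ = cubeSum (λ X → g₀ X * t₁ X)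
  C₁₀ = cubeSum (λ X → g₁ X * t₀ X)
  expand : ∀ a b → (a + b) * (a + b) ≡ a * a + b * b + a * b * 2
  expand = solve-∀
  square : ∀ (a b : Subset n → ℕ) → cubeSum (λ X → (a X + b X) * (a X + b X))
    ≡ cubeSum (λ X → a X * a X) + cubeSum (λ X → b X * b X) + cubeSum (λ X → a X * b X) * 2
  square a b = trans (cubeSum-cong (λ X → expand (a X) (b X)))
    (trans (cubeSum-distrib-+ (λ X → a X * a X + b X * b X) _)
      (cong₂ _+_ (cubeSum-distrib-+ (λ X → a X * a X) _) (cubeSum-distribʳ-* (λ X → a X * b X) 2)))
  distribˡ : ∀ a b c → a * (b + c) ≡ a * b + a * c
  distribˡ = solve-∀
  distrib : ∀ (a b c : Subset n → ℕ) →
    cubeSum (λ X → a X * (b X + c X)) ≡ cubeSum (λ X → a X * b X) + cubeSum (λ X → a X * c X)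
  distrib a b c = trans (cubeSum-cong (λ X → distribˡ (a X) (b X) (c X))) (cubeSum-distrib-+ (λ X → a X * b X) _)
  rearrange : ∀ n G₀ G₁ S₀ S₁ C₁₀ C₀₁ →
    (G₁ + (n * G₀ + 2 * S₀) + C₁₀ * 2) + (G₀ + (n * G₁ + 2 * S₁) + C₀₁ * 2)
      ≡ suc n * (G₀ + G₁) + 2 * ((C₀₁ + S₀) + (C₁₀ + S₁))
  rearrange = solve-∀

-- Here the sphere is described by the size of a symmetric difference; `cubeSum-puncture` reconciles
-- this with the recursive `sphereSum`.
puncture : ∀ {n} → ℕ → Subset n → (Subset n → ℕ) → Subset n → ℕ
puncture r X g Y = if ∣ X △ Y ∣ ≡ᵇ r then 0 else g Y

cubeSum-puncture : ∀ {n} r (X : Subset n) (g : Subset n → ℕ) →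
  cubeSum (puncture r X g) + sphereSum r X g ≡ cubeSum g
cubeSum-puncture zero    []          g = refl
cubeSum-puncture (suc r) []          g = +-identityʳ _
cubeSum-puncture zero    (false ∷ X) g = begin
  cubeSum (puncture 0 X g₀) + cubeSum g₁ + g₀ X   ≡⟨ swap (cubeSum (puncture 0 X g₀)) (cubeSum g₁) (g₀ X) ⟩
  (cubeSum (puncture 0 X g₀) + g₀ X) + cubeSum g₁ ≡⟨ cong (_+ cubeSum g₁) (cubeSum-puncture 0 X g₀) ⟩
  cubeSum g₀ + cubeSum g₁                         ∎
  where
  open ≡-Reasoning
  g₀ g₁ : Subset _ → ℕ
  g₀ = g ∘ (false ∷_)
  g₁ = g ∘ (true ∷_)
  swap : ∀ a b c → (a + b) + c ≡ (a + c) + b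
  swap = solve-∀
cubeSum-puncture zero    (true ∷ X)  g =
  trans (+-assoc (cubeSum (g ∘ (false ∷_))) _ _) (cong (cubeSum (g ∘ (false ∷_)) +_) (cubeSum-puncture 0 X (g ∘ (true ∷_))))
cubeSum-puncture (suc r) (false ∷ X) g = begin
  (cubeSum (puncture (suc r) X g₀) + cubeSum (puncture r X g₁)) + (sphereSum r X g₁ + sphereSum (suc r) X g₀)
    ≡⟨ swap (cubeSum (puncture (suc r) X g₀)) (cubeSum (puncture r X g₁)) (sphereSum r X g₁) _ ⟩
  (cubeSum (puncture (suc r) X g₀) + sphereSum (suc r) X g₀) + (cubeSum (puncture r X g₁) + sphereSum r X g₁)
    ≡⟨ cong₂ _+_ (cubeSum-puncture (suc r) X g₀) (cubeSum-puncture r X g₁) ⟩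
  cubeSum g₀ + cubeSum g₁ ∎
  where
  open ≡-Reasoning
  g₀ g₁ : Subset _ → ℕ
  g₀ = g ∘ (false ∷_)
  g₁ = g ∘ (true ∷_)
  swap : ∀ a b c d → (a + b) + (c + d) ≡ (a + d) + (b + c)
  swap = solve-∀
cubeSum-puncture (suc r) (true ∷ X)  g = begin
  (cubeSum (puncture r X g₀) + cubeSum (puncture (suc r) X g₁)) + (sphereSum r X g₀ + sphereSum (suc r) X g₁)
    ≡⟨ swap (cubeSum (puncture r X g₀)) (cubeSum (puncture (suc r) X g₁)) (sphereSum r X g₀) _ ⟩
  (cubeSum (puncture r X g₀) + sphereSum r X g₀) + (cubeSum (puncture (suc r) X g₁) + sphereSum (suc r) X g₁)
    ≡⟨ cong₂ _+_ (cubeSum-puncture r X g₀) (cubeSum-puncture (suc r) X g₁) ⟩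
  cubeSum g₀ + cubeSum g₁ ∎
  where
  open ≡-Reasoning
  g₀ g₁ : Subset _ → ℕ
  g₀ = g ∘ (false ∷_)
  g₁ = g ∘ (true ∷_)
  swap : ∀ a b c d → (a + b) + (c + d) ≡ (a + c) + (b + d)
  swap = solve-∀

-- Covering a family by few spheres of radius two

⟦_⟧ : Bool → ℕ
⟦ b ⟧ = if b then 1 else 0

size : ∀ {n} → (Subset n → Bool) → ℕ
size g = cubeSum (λ X → ⟦ g X ⟧)

⟦b⟧*⟦b⟧≡⟦b⟧ : ∀ b → ⟦ b ⟧ * ⟦ b ⟧ ≡ ⟦ b ⟧
⟦b⟧*⟦b⟧≡⟦b⟧ true  = refl
⟦b⟧*⟦b⟧≡⟦b⟧ false = refl

-- At least n² / (8 M) members at distance two, cleared of division.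
Dense : ∀ {n} → ℕ → (Subset n → Bool) → Subset n → Set
Dense {n} M g X = g X ≡ true × n * n ≤ sphereSum 2 X (⟦_⟧ ∘ g) * (8 * M)

dense? : ∀ {n} M (g : Subset n → Bool) → Dec (∃[ X ] Dense M g X)
dense? {n} M g = anySubset? (λ X → (g X ≟ᵇ true) ×-dec (n * n ≤? sphereSum 2 X (⟦_⟧ ∘ g) * (8 * M)))

-- Second moment of the neighbour count t: with s = `size g`, Σ t = n s and hence n² s² ≤ 2 ^ n Σ
-- t². In 8 M Σ t² the diagonal contributes at most 2 n² s because 4 M ≤ n, and the pairs at
-- distance two contribute at most 2 n² s because no member is dense.
sparse⇒small : ∀ {n} .{{_ : NonZero n}} M → 4 * M ≤ n → (g : Subset n → Bool) →
  (∀ X → ¬ Dense M g X) → size g * (2 * M) ≤ 2 ^ n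
sparse⇒small {n} M 4M≤n g ¬dense = cancel (size g) (begin
    size g * (2 * M) * (size g * (4 * (n * n)))          ≡⟨ reassoc (size g) M n ⟩
    (n * size g) * (n * size g) * (8 * M)       ≡⟨ cong (λ a → a * a * (8 * M)) (cubeSum-sphereSum-1 h) ⟨
    cubeSum t * cubeSum t * (8 * M)             ≤⟨ *-monoˡ-≤ (8 * M) (cubeSum-Cauchy-Schwarz t) ⟩
    2 ^ n * cubeSum (λ X → t X * t X) * (8 * M) ≡⟨ *-assoc (2 ^ n) _ (8 * M) ⟩
    2 ^ n * (cubeSum (λ X → t X * t X) * (8 * M)) ≤⟨ *-monoʳ-≤ (2 ^ n) moment ⟩
    2 ^ n * (size g * (4 * (n * n)))            ∎)
  where
  open ≤-Reasoning
  h t : Subset n → ℕ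
  h = ⟦_⟧ ∘ g
  t X = sphereSum 1 X h
  reassoc : ∀ s M n → s * (2 * M) * (s * (4 * (n * n))) ≡ (n * s) * (n * s) * (8 * M)
  reassoc = solve-∀
  pointwise : ∀ X → h X * sphereSum 2 X h * (8 * M) ≤ h X * (n * n)
  pointwise X with g X in gX
  ... | false = z≤n
  ... | true with n * n ≤? sphereSum 2 X h * (8 * M)
  ...   | yes le = contradiction (gX , le) (¬dense X)
  ...   | no  ≰  = ≤-trans (≤-reflexive (cong (_* (8 * M)) (*-identityˡ (sphereSum 2 X h)))) (≤-trans (<⇒≤ (≰⇒> ≰)) (≤-reflexive (sym (*-identityˡ _))))
  pairs : cubeSum (λ X → h X * sphereSum 2 X h) * (8 * M) ≤ size g * (n * n)
  pairs = begin
    cubeSum (λ X → h X * sphereSum 2 X h) * (8 * M)   ≡⟨ cubeSum-distribʳ-* (λ X → h X * sphereSum 2 X h) (8 * M) ⟨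
    cubeSum (λ X → h X * sphereSum 2 X h * (8 * M))   ≤⟨ cubeSum-mono pointwise ⟩
    cubeSum (λ X → h X * (n * n))                     ≡⟨ cubeSum-distribʳ-* h (n * n) ⟩
    size g * (n * n)                                  ∎
  expand : ∀ n s p M → (n * s + 2 * p) * (8 * M) ≡ 2 * (n * s * (4 * M)) + 2 * (p * (8 * M))
  expand = solve-∀
  collect : ∀ n s → 2 * (n * s * n) + 2 * (s * (n * n)) ≡ s * (4 * (n * n))
  collect = solve-∀
  moment : cubeSum (λ X → t X * t X) * (8 * M) ≤ size g * (4 * (n * n))
  moment = begin
    cubeSum (λ X → t X * t X) * (8 * M)
      ≡⟨ cong (_* (8 * M)) (cubeSum-sphereSum-1² h) ⟩
    (n * cubeSum (λ X → h X * h X) + 2 * cubeSum (λ X → h X * sphereSum 2 X h)) * (8 * M)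
      ≡⟨ cong (λ a → (n * a + 2 * P) * (8 * M)) (cubeSum-cong (λ X → ⟦b⟧*⟦b⟧≡⟦b⟧ (g X))) ⟩
    (n * size g + 2 * P) * (8 * M)
      ≡⟨ expand n (size g) P M ⟩
    2 * (n * size g * (4 * M)) + 2 * (P * (8 * M))
      ≤⟨ +-mono-≤ (*-monoʳ-≤ 2 (*-monoʳ-≤ (n * size g) 4M≤n)) (*-monoʳ-≤ 2 pairs) ⟩
    2 * (n * size g * n) + 2 * (size g * (n * n))
      ≡⟨ collect n (size g) ⟩
    size g * (4 * (n * n)) ∎
    where
    P : ℕ
    P = cubeSum (λ X → h X * sphereSum 2 X h)
  cancel : ∀ s → s * (2 * M) * (s * (4 * (n * n))) ≤ 2 ^ n * (s * (4 * (n * n))) → s * (2 * M) ≤ 2 ^ n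
  cancel zero    _  = z≤n
  cancel s@(suc _) le = *-cancelʳ-≤ _ _ (s * (4 * (n * n))) {{nz n}} le
    where
    nz : ∀ n .{{_ : NonZero n}} → NonZero (s * (4 * (n * n)))
    nz (suc n) = _

-- Centres must lie in g because only infeasible sets have a multipartite neighbourhood; R must lie
-- in g because its members will be declared infeasible. A centre is at distance zero from itself,
-- so its own sphere does not cover it.
Covers : ∀ {n} → (Subset n → Bool) → List (Subset n) → (Subset n → Bool) → Set
Covers g D R = All (λ X → g X ≡ true) D
             × (∀ Y → R Y ≡ true → g Y ≡ true)
             × (∀ Y → g Y ≡ true → R Y ≡ true ⊎ Any (λ X → ∣ X △ Y ∣ ≡ 2) D)

covers-refl : ∀ {n} (g : Subset n → Bool) → Covers g [] g
covers-refl g = [] , (λ _ p → p) , λ _ → inj₁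

covers-trans : ∀ {n} {g R R′ : Subset n → Bool} {D D′} → Covers g D R → Covers R D′ R′ → Covers g (D ++ D′) R′
covers-trans {D = D} (D⊆g , R⊆g , cov) (D′⊆R , R′⊆R , cov′) =
  All.++⁺ D⊆g (All.map (R⊆g _) D′⊆R) , (λ Y → R⊆g Y ∘ R′⊆R Y) ,
  λ Y gY → case cov Y gY of λ where
    (inj₂ any) → inj₂ (Any.++⁺ˡ any)
    (inj₁ RY)  → case cov′ Y RY of λ where
      (inj₁ R′Y) → inj₁ R′Y
      (inj₂ any) → inj₂ (Any.++⁺ʳ D any)

removeSphere : ∀ {n} → Subset n → (Subset n → Bool) → Subset n → Bool
removeSphere X g Y = if ∣ X △ Y ∣ ≡ᵇ 2 then false else g Y

covers-removeSphere : ∀ {n} (X : Subset n) g → g X ≡ true → Covers g (X ∷ []) (removeSphere X g)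
covers-removeSphere X g gX = gX ∷ [] , sub , cov
  where
  sub : ∀ Y → removeSphere X g Y ≡ true → g Y ≡ true
  sub Y eq with ∣ X △ Y ∣ ≡ᵇ 2
  sub Y () | true
  sub Y eq | false = eq
  cov : ∀ Y → g Y ≡ true → removeSphere X g Y ≡ true ⊎ Any (λ X → ∣ X △ Y ∣ ≡ 2) (X ∷ [])
  cov Y gY with ∣ X △ Y ∣ ≡ᵇ 2 in eq
  ... | true  = inj₂ (here (≡ᵇ⇒≡ _ 2 (subst T (sym eq) _)))
  ... | false = inj₁ gY

size-removeSphere : ∀ {n} (X : Subset n) g → size (removeSphere X g) + sphereSum 2 X (⟦_⟧ ∘ g) ≡ size g
size-removeSphere X g = trans (cong (_+ sphereSum 2 X (⟦_⟧ ∘ g)) (cubeSum-cong pointwise)) (cubeSum-puncture 2 X (⟦_⟧ ∘ g))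
  where
  pointwise : ∀ Y → ⟦ removeSphere X g Y ⟧ ≡ puncture 2 X (⟦_⟧ ∘ g) Y
  pointwise Y with ∣ X △ Y ∣ ≡ᵇ 2
  ... | true  = refl
  ... | false = refl

-- Amortised count: removing the sphere of a dense centre lowers `size g * (8 * M)` by at least n²,
-- which pays for that centre. The sphere meets g, so `size g` bounds the number of steps and serves
-- as fuel.
greedy : ∀ {n} .{{_ : NonZero n}} M → 4 * M ≤ n → (g : Subset n → Bool) → ∀ fuel → size g ≤ fuel →
  ∃[ D ] ∃[ R ] (Covers g D R × size R * (2 * M) ≤ 2 ^ n
                 × length D * (n * n) + size R * (8 * M) ≤ size g * (8 * M))
greedy {n} M 4M≤n g fuel le with dense? M g
greedy {n} M 4M≤n g fuel le | no ¬dense =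
  [] , g , covers-refl g , sparse⇒small M 4M≤n g (λ X d → ¬dense (X , d)) , ≤-refl
greedy {n} M 4M≤n g fuel le | yes (X , gX , dense) = continue fuel le
  where
  open ≤-Reasoning
  g′ : Subset n → Bool
  g′ = removeSphere X g
  s : ℕ
  s = sphereSum 2 X (⟦_⟧ ∘ g)
  s>0 : 0 < s
  s>0 = pos s (<-≤-trans (sq n) dense)
    where
    sq : ∀ n .{{_ : NonZero n}} → 0 < n * n
    sq (suc n) = s≤s z≤n
    pos : ∀ s → 0 < s * (8 * M) → 0 < s
    pos (suc s) _ = s≤s z≤n
  shrink : suc (size g′) ≤ size g
  shrink = begin
    suc (size g′) ≡⟨ +-comm 1 _ ⟩
    size g′ + 1   ≤⟨ +-monoʳ-≤ (size g′) s>0 ⟩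
    size g′ + s   ≡⟨ size-removeSphere X g ⟩
    size g        ∎
  continue : ∀ fuel → size g ≤ fuel → ∃[ D ] ∃[ R ] (Covers g D R × size R * (2 * M) ≤ 2 ^ n
                 × length D * (n * n) + size R * (8 * M) ≤ size g * (8 * M))
  continue zero le = contradiction (≤-trans shrink le) λ ()
  continue (suc fuel) le with greedy M 4M≤n g′ fuel (+-cancelʳ-≤ 1 _ _ (begin
      size g′ + 1 ≡⟨ +-comm _ 1 ⟩ suc (size g′) ≤⟨ shrink ⟩ size g ≤⟨ le ⟩ suc fuel ≡⟨ +-comm 1 fuel ⟩ fuel + 1 ∎))
  ... | D , R , cov , small , cost =
    X ∷ D , R , covers-trans (covers-removeSphere X g gX) cov , small , (begin
      (n * n + length D * (n * n)) + size R * (8 * M) ≡⟨ reassoc (n * n) _ _ ⟩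
      (length D * (n * n) + size R * (8 * M)) + n * n ≤⟨ +-mono-≤ cost dense ⟩
      size g′ * (8 * M) + s * (8 * M)                 ≡⟨ *-distribʳ-+ (8 * M) (size g′) s ⟨
      (size g′ + s) * (8 * M)                         ≡⟨ cong (_* (8 * M)) (size-removeSphere X g) ⟩
      size g * (8 * M)                                ∎)
    where
    reassoc : ∀ a b c → (a + b) + c ≡ (b + c) + a
    reassoc = solve-∀

size≤2^n : ∀ {n} (g : Subset n → Bool) → size g ≤ 2 ^ n
size≤2^n {n} g = ≤-trans (cubeSum-mono (λ X → ⟦b⟧≤1 (g X))) (≤-reflexive (cubeSum-1 n))
  where
  ⟦b⟧≤1 : ∀ b → ⟦ b ⟧ ≤ 1
  ⟦b⟧≤1 true  = ≤-refl
  ⟦b⟧≤1 false = z≤n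

-- The next round runs `greedy` with M = 2 ^ j on a remainder of at most 2 ^ n / 2 ^ j sets. It adds
-- at most 8 · 2 ^ n / n² centres, and the factor 2 in `sparse⇒small` halves the bound on the
-- remainder.
cover : ∀ {n} .{{_ : NonZero n}} j → 2 * 2 ^ j ≤ n → (g : Subset n → Bool) →
  ∃[ D ] ∃[ R ] (Covers g D R × size R * 2 ^ j ≤ 2 ^ n × length D * (n * n) ≤ j * (8 * 2 ^ n))
cover zero    _  g = [] , g , covers-refl g , ≤-trans (≤-reflexive (*-identityʳ _)) (size≤2^n g) , z≤n
cover {n} (suc j) le g with cover j (≤-trans (*-monoʳ-≤ 2 (m≤m+n (2 ^ j) _)) le) g
... | D , R , cov , small , cost with greedy (2 ^ j) (≤-trans (≤-reflexive (four (2 ^ j))) le) R (size R) ≤-refl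
  where
  four : ∀ m → 4 * m ≡ 2 * (2 * m)
  four = solve-∀
... | D′ , R′ , cov′ , small′ , cost′ = D ++ D′ , R′ , covers-trans cov cov′ , small′ , (begin
  length (D ++ D′) * (n * n)                     ≡⟨ cong (_* (n * n)) (length-++ D) ⟩
  (length D + length D′) * (n * n)               ≡⟨ *-distribʳ-+ (n * n) (length D) _ ⟩
  length D * (n * n) + length D′ * (n * n)       ≤⟨ +-mono-≤ cost (≤-trans (m≤m+n _ _) cost′) ⟩
  j * (8 * 2 ^ n) + size R * (8 * 2 ^ j)         ≡⟨ reassoc j (size R) (2 ^ j) (2 ^ n) ⟩
  8 * (size R * 2 ^ j) + j * (8 * 2 ^ n)         ≤⟨ +-monoˡ-≤ _ (*-monoʳ-≤ 8 small) ⟩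
  suc j * (8 * 2 ^ n)                            ∎)
  where
  open ≤-Reasoning
  reassoc : ∀ j s a b → j * (8 * b) + s * (8 * a) ≡ 8 * (s * a) + j * (8 * b)
  reassoc = solve-∀

-- Local structure

flip-involutive : ∀ {n} (i : Fin n) X → flip i (flip i X) ≡ X
flip-involutive i X = trans (updateAt-updateAt i X) (trans (updateAt-cong i not-involutive X) (updateAt-id i X))

flip-comm : ∀ {n} (i j : Fin n) X → flip i (flip j X) ≡ flip j (flip i X)
flip-comm i j X with i ≟ᶠ j
... | yes refl = refl
... | no  i≢j  = updateAt-commutes i j i≢j X

X△⊥ : ∀ {n} (X : Subset n) → X △ ⊥ ≡ X
X△⊥ = zipWith-identityʳ xor-identityʳ

△-⁅⁆ : ∀ {n} (X : Subset n) e → X △ ⁅ e ⁆ ≡ flip e X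
△-⁅⁆ (x ∷ X) zero    = cong₂ _∷_ (xor-comm x true) (X△⊥ X)
△-⁅⁆ (x ∷ X) (suc e) = cong₂ _∷_ (xor-identityʳ x) (△-⁅⁆ X e)

△-⁅⁆∪⁅⁆ : ∀ {n} (X : Subset n) {e f} → e ≢ f → X △ (⁅ e ⁆ ∪ ⁅ f ⁆) ≡ flip e (flip f X)
△-⁅⁆∪⁅⁆ (x ∷ X) {zero}  {zero}  e≢f = contradiction refl e≢f
△-⁅⁆∪⁅⁆ (x ∷ X) {zero}  {suc f} e≢f =
  cong₂ _∷_ (xor-comm x true) (trans (cong (X △_) (∪-identityˡ ⁅ f ⁆)) (△-⁅⁆ X f))
△-⁅⁆∪⁅⁆ (x ∷ X) {suc e} {zero}  e≢f =
  cong₂ _∷_ (xor-comm x true) (trans (cong (X △_) (∪-identityʳ ⁅ e ⁆)) (△-⁅⁆ X e))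
△-⁅⁆∪⁅⁆ (x ∷ X) {suc e} {suc f} e≢f = cong₂ _∷_ (xor-identityʳ x) (△-⁅⁆∪⁅⁆ X (e≢f ∘ cong suc))

△-⁅⁆∪⁅⁆-same : ∀ {n} (X : Subset n) e → X △ (⁅ e ⁆ ∪ ⁅ e ⁆) ≡ flip e X
△-⁅⁆∪⁅⁆-same (x ∷ X) zero    = cong₂ _∷_ (xor-comm x true) (trans (cong (X △_) (∪-identityˡ ⊥)) (X△⊥ X))
△-⁅⁆∪⁅⁆-same (x ∷ X) (suc e) = cong₂ _∷_ (xor-identityʳ x) (△-⁅⁆∪⁅⁆-same X e)

flip-△ : ∀ {n} e (X Y : Subset n) → flip e X △ Y ≡ flip e (X △ Y)
flip-△ zero    (true  ∷ X) (y ∷ Y) = cong (_∷ (X △ Y)) (sym (not-involutive y))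
flip-△ zero    (false ∷ X) (y ∷ Y) = refl
flip-△ (suc e) (x ∷ X)     (y ∷ Y) = cong ((x xor y) ∷_) (flip-△ e X Y)

∈△⇒≢ : ∀ {n} (X Y : Subset n) {e} → e Subset.∈ (X △ Y) → lookup X e ≢ lookup Y e
∈△⇒≢ X Y {e} e∈ eq = contradiction (trans (sym ([]=⇒lookup e∈)) (trans (lookup-zipWith _xor_ e X Y)
  (trans (cong (_xor lookup Y e) eq) (xor-same (lookup Y e))))) λ ()

≢⇒∈△ : ∀ {n} (X Y : Subset n) {e} → lookup X e ≢ lookup Y e → e Subset.∈ (X △ Y)
≢⇒∈△ X Y {e} x≢y = lookup⇒[]= e _ (trans (lookup-zipWith _xor_ e X Y) (xor-true (lookup X e) (lookup Y e) x≢y))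
  where
  xor-true : ∀ a b → a ≢ b → a xor b ≡ true
  xor-true true  true  a≢b = contradiction refl a≢b
  xor-true true  false a≢b = refl
  xor-true false true  a≢b = refl
  xor-true false false a≢b = contradiction refl a≢b

∣△∣≡0 : ∀ {n} (X Y : Subset n) → ∣ X △ Y ∣ ≡ 0 → X ≡ Y
∣△∣≡0 []          []          _  = refl
∣△∣≡0 (true ∷ X)  (true ∷ Y)  eq = cong (true ∷_) (∣△∣≡0 X Y eq)
∣△∣≡0 (false ∷ X) (false ∷ Y) eq = cong (false ∷_) (∣△∣≡0 X Y eq)

∣△∣≡suc : ∀ {n} (X Y : Subset n) {k} → ∣ X △ Y ∣ ≡ suc k → ∃[ a ] ∣ flip a X △ Y ∣ ≡ k
∣△∣≡suc []          []          ()
∣△∣≡suc (true ∷ X)  (false ∷ Y) eq = zero , suc-injective eq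
∣△∣≡suc (false ∷ X) (true ∷ Y)  eq = zero , suc-injective eq
∣△∣≡suc (true ∷ X)  (true ∷ Y)  eq = let a , eq′ = ∣△∣≡suc X Y eq in suc a , eq′
∣△∣≡suc (false ∷ X) (false ∷ Y) eq = let a , eq′ = ∣△∣≡suc X Y eq in suc a , eq′

∣△∣≡2 : ∀ {n} (X Y : Subset n) → ∣ X △ Y ∣ ≡ 2 → ∃[ a ] ∃[ b ] Y ≡ flip a (flip b X)
∣△∣≡2 X Y eq =
  let b , eq₁ = ∣△∣≡suc X Y eq
      a , eq₀ = ∣△∣≡suc (flip b X) Y eq₁
  in a , b , sym (∣△∣≡0 _ Y eq₀)

odd : ℕ → Bool
odd zero    = false
odd (suc n) = not (odd n)

%2≡odd : ∀ n → n % 2 ≡ (if odd n then 1 else 0)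
%2≡odd zero          = refl
%2≡odd (suc zero)    = refl
%2≡odd (suc (suc n)) = trans (trans (cong (_% 2) (+-comm 2 n)) ([m+n]%n≡m%n n 2)) (trans (%2≡odd n)
  (cong (λ b → if b then 1 else 0) (sym (not-involutive (odd n)))))

%2-injective : ∀ m n → m % 2 ≡ n % 2 → odd m ≡ odd n
%2-injective m n eq = inj (odd m) (odd n) (trans (sym (%2≡odd m)) (trans eq (%2≡odd n)))
  where
  inj : ∀ a b → (if a then 1 else 0) ≡ (if b then 1 else 0) → a ≡ b
  inj true  true  _ = refl
  inj false false _ = refl

odd-flip : ∀ {n} e (X : Subset n) → odd ∣ flip e X ∣ ≡ not (odd ∣ X ∣)
odd-flip zero    (true ∷ X)  = sym (not-involutive _)
odd-flip zero    (false ∷ X) = refl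
odd-flip (suc e) (true ∷ X)  = cong not (odd-flip e X)
odd-flip (suc e) (false ∷ X) = odd-flip e X

lookup-flip₂ : ∀ {n} {i j k : Fin n} X → k ≢ i → k ≢ j → lookup (flip i (flip j X)) k ≡ lookup X k
lookup-flip₂ {i = i} {j} {k} X k≢i k≢j = trans (lookup∘updateAt′ k i k≢i (flip j X)) (lookup∘updateAt′ k j k≢j X)

-- nonEdge-trans says that non-adjacency is transitive through non-isolated vertices:
-- the non-isolated vertices span a complete multipartite graph.
module Neighbourhood {n : ℕ} (φ : Subset n → Bool)
  (exchange : ∀ X Y → φ X ≡ true → φ Y ≡ true → ∀ e → e Subset.∈ (X △ Y) →
              ∃[ f ] (f Subset.∈ (X △ Y) × φ (X △ (⁅ e ⁆ ∪ ⁅ f ⁆)) ≡ true))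
  (parity : ∀ X Y → φ X ≡ true → φ Y ≡ true → odd ∣ X ∣ ≡ odd ∣ Y ∣)
  (X : Subset n) (infeasible : φ X ≡ false) where

  edge : Fin n → Fin n → Bool
  edge a b = φ (flip a (flip b X))

  edge-irrefl : ∀ a → edge a a ≡ false
  edge-irrefl a = trans (cong φ (flip-involutive a X)) infeasible

  edge-sym : ∀ a b → edge a b ≡ edge b a
  edge-sym a b = cong φ (flip-comm a b X)

  edge⇒≢ : ∀ {a b} → edge a b ≡ true → a ≢ b
  edge⇒≢ e refl = contradiction (trans (sym e) (edge-irrefl _)) λ ()

  nonEdge-trans : ∀ {a m b d} → edge m d ≡ true → edge a m ≡ false → edge m b ≡ false → edge a b ≡ false
  nonEdge-trans {a} {m} {b} {d} md am mb with edge a b in ab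
  ... | false = refl
  -- If a b were an edge, U = X △ {m, d} and V = X △ {a, b} would both be feasible. Exchanging d in
  -- U towards V leaves X △ {m, f} with f in {m, a, b}, since f = d would change the parity. But f =
  -- m gives the infeasible X, and a, b are not adjacent to m.
  ... | true  = ⊥-elim (absurd (exchange U V md ab d d∈))
    where
    U V : Subset n
    U = flip m (flip d X)
    V = flip a (flip b X)
    clash : ∀ {b} → b ≡ true → b ≡ false → ∀ {A : Set} → A
    clash refl ()
    m≢d : m ≢ d
    m≢d = edge⇒≢ md
    d≢a : d ≢ a
    d≢a refl = clash md (trans (edge-sym _ _) am)
    d≢b : d ≢ b
    d≢b refl = clash md mb
    U≡ : U ≡ flip d (flip m X)
    U≡ = flip-comm m d X
    d∈ : d Subset.∈ (U △ V)
    d∈ = ≢⇒∈△ U V λ eq → not-¬ refl (trans (sym (lookup-flip₂ X d≢a d≢b)) (trans (sym eq)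
      (trans (cong (λ W → lookup W d) U≡) (trans (lookup∘updateAt d (flip m X)) (cong not (lookup∘updateAt′ d m (≢-sym m≢d) X))))))
    dU : flip d U ≡ flip m X
    dU = trans (cong (flip d) U≡) (flip-involutive d (flip m X))
    absurd : ¬ (∃[ f ] (f Subset.∈ (U △ V) × φ (U △ (⁅ d ⁆ ∪ ⁅ f ⁆)) ≡ true))
    absurd (f , f∈ , feasible) with d ≟ᶠ f
    ... | yes refl = not-¬ refl (trans (sym
      (parity _ _ (trans (cong φ (sym (△-⁅⁆∪⁅⁆-same U d))) feasible) md)) (odd-flip d U))
    ... | no d≢f = cases (f ≟ᶠ m) (f ≟ᶠ a) (f ≟ᶠ b)
      where
      fm : edge f m ≡ true
      fm = trans (cong φ (sym (trans (△-⁅⁆∪⁅⁆ U d≢f) (trans (flip-comm d f U) (cong (flip f) dU))))) feasible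
      cases : Dec (f ≡ m) → Dec (f ≡ a) → Dec (f ≡ b) → Empty.⊥
      cases (yes refl) _ _ = clash fm (edge-irrefl f)
      cases _ (yes refl) _ = clash fm am
      cases _ _ (yes refl) = clash fm (trans (edge-sym _ _) mb)
      cases (no f≢m) (no f≢a) (no f≢b) =
        ∈△⇒≢ U V f∈ (trans (lookup-flip₂ X f≢m (≢-sym d≢f)) (sym (lookup-flip₂ X f≢a f≢b)))

-- Naming the parts of a complete multipartite graph

firstIndex : ∀ {n} → (Fin n → Bool) → Maybe (Fin n)
firstIndex {zero}  P = nothing
firstIndex {suc n} P = if P zero then just zero else Maybe.map suc (firstIndex (P ∘ suc))

firstIndex-cong : ∀ {n} {P Q : Fin n → Bool} → (∀ i → P i ≡ Q i) → firstIndex P ≡ firstIndex Q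
firstIndex-cong {zero}  eq = refl
firstIndex-cong {suc n} eq = cong₂ (λ b r → if b then just zero else Maybe.map suc r) (eq zero) (firstIndex-cong (eq ∘ suc))

firstIndex-just : ∀ {n} (P : Fin n → Bool) {m} → firstIndex P ≡ just m → P m ≡ true
firstIndex-just {suc n} P eq with P zero in P0
firstIndex-just {suc n} P refl | true = P0
firstIndex-just {suc n} P eq   | false with firstIndex (P ∘ suc) in first
firstIndex-just {suc n} P refl | false | just m = firstIndex-just (P ∘ suc) first

firstIndex-nothing : ∀ {n} (P : Fin n → Bool) → firstIndex P ≡ nothing → ∀ i → P i ≡ false
firstIndex-nothing {suc n} P eq i with P zero in P0
firstIndex-nothing {suc n} P eq i | false with firstIndex (P ∘ suc) in first
firstIndex-nothing {suc n} P eq zero    | false | nothing = P0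
firstIndex-nothing {suc n} P eq (suc i) | false | nothing = firstIndex-nothing (P ∘ suc) first i

Labelling : ℕ → Set
Labelling n = Vec (Maybe (Fin n)) n

-- The label nothing marks the isolated vertices, every other label a part.
Separated : ∀ {n} → Labelling n → Fin n → Fin n → Set
Separated p a b = lookup p a ≡ nothing ⊎ lookup p b ≡ nothing ⊎ lookup p a ≡ lookup p b

module Label {n : ℕ} (edge : Fin n → Fin n → Bool) where

  HasEdge : Fin n → Set
  HasEdge a = ∃[ d ] edge a d ≡ true

  hasEdge? : ∀ a → Dec (HasEdge a)
  hasEdge? a = any? (λ d → edge a d ≟ᵇ true)

  -- Non-adjacency is an equivalence only on the non-isolated vertices; requiring an edge at a as
  -- well leaves isolated vertices without any candidate label.
  samePart : Fin n → Fin n → Bool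
  samePart a m = does (hasEdge? a) ∧ (does (hasEdge? m) ∧ not (edge a m))

  -- A part is named by its least member, so no names beyond the n vertices are needed.
  label : Labelling n
  label = tabulate (λ a → firstIndex (samePart a))

  module Multipartite
    (edge-irrefl : ∀ a → edge a a ≡ false) (edge-sym : ∀ a b → edge a b ≡ edge b a)
    (nonEdge-trans : ∀ {a m b d} → edge m d ≡ true → edge a m ≡ false → edge m b ≡ false → edge a b ≡ false)
    where

    does⇒ : ∀ {a} → does (hasEdge? a) ≡ true → HasEdge a
    does⇒ {a} eq with hasEdge? a
    ... | yes h = h

    samePart-elim : ∀ {a m} → samePart a m ≡ true → HasEdge m × edge a m ≡ false
    samePart-elim {a} {m} eq =
      let rest = ∧-conicalʳ (does (hasEdge? a)) _ eq
      in does⇒ (∧-conicalˡ _ _ rest) , not-injective {y = false} (∧-conicalʳ (does (hasEdge? m)) _ rest)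

    samePart-refl : ∀ {a} → HasEdge a → samePart a a ≡ true
    samePart-refl {a} h rewrite dec-true (hasEdge? a) h | edge-irrefl a = refl

    lookup-label : ∀ a → lookup label a ≡ firstIndex (samePart a)
    lookup-label a = lookup∘tabulate _ a

    unlabelled : ∀ {a} b → lookup label a ≡ nothing → edge a b ≡ false
    unlabelled {a} b eq with edge a b in ab
    ... | false = refl
    ... | true  = contradiction
      (trans (sym (samePart-refl (b , ab))) (firstIndex-nothing _ (trans (sym (lookup-label a)) eq) a)) λ ()

    -- Vertices with the common label m are both non-adjacent to m, and m has an edge, so
    -- `nonEdge-trans` passes through m.
    Separated⇒nonEdge : ∀ {a b} → Separated label a b → edge a b ≡ false
    Separated⇒nonEdge {a} {b} (inj₁ eq) = unlabelled b eq
    Separated⇒nonEdge {a} {b} (inj₂ (inj₁ eq)) = trans (edge-sym a b) (unlabelled a eq)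
    Separated⇒nonEdge {a} {b} (inj₂ (inj₂ eq)) with firstIndex (samePart a) in fa
    ... | nothing = unlabelled b (trans (lookup-label a) fa)
    ... | just m  =
      let (_ , md) , am = samePart-elim (firstIndex-just (samePart a) fa)
          _ , bm = samePart-elim (firstIndex-just (samePart b) (trans (sym (lookup-label b)) (trans (sym eq) (trans (lookup-label a) fa))))
      in nonEdge-trans md am (trans (edge-sym m b) bm)

    ¬HasEdge⇒unlabelled : ∀ {a} → ¬ HasEdge a → lookup label a ≡ nothing
    ¬HasEdge⇒unlabelled {a} ¬h with firstIndex (samePart a) in fa
    ... | nothing = trans (lookup-label a) fa
    ... | just m  = contradiction (does⇒ (∧-conicalˡ _ _ (firstIndex-just (samePart a) fa))) ¬h

    -- Applied in both directions, `nonEdge-trans` shows that non-adjacent, non-isolated a and b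
    -- have the same neighbours; their labels are then least indices of the same predicate.
    nonEdge⇒Separated : ∀ {a b} → edge a b ≡ false → Separated label a b
    nonEdge⇒Separated {a} {b} ab with hasEdge? a | hasEdge? b
    ... | no ¬ha | _ = inj₁ (¬HasEdge⇒unlabelled ¬ha)
    ... | yes _ | no ¬hb = inj₂ (inj₁ (¬HasEdge⇒unlabelled ¬hb))
    ... | yes ha@(_ , ad) | yes hb@(_ , bd) =
      inj₂ (inj₂ (trans (lookup-label a) (trans (firstIndex-cong same) (sym (lookup-label b)))))
      where
      iff : ∀ m → edge a m ≡ edge b m
      iff m with edge a m in am | edge b m in bm
      ... | true  | true  = refl
      ... | false | false = refl
      ... | false | true  = trans (sym (nonEdge-trans ad (trans (edge-sym b a) ab) am)) bm
      ... | true  | false = trans (sym am) (nonEdge-trans bd ab bm)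
      same : ∀ m → samePart a m ≡ samePart b m
      same m rewrite dec-true (hasEdge? a) ha | dec-true (hasEdge? b) hb | iff m = refl

-- Counting lists

length-cartesianProductWith : ∀ {A B C : Set} (f : A → B → C) xs ys →
  length (cartesianProductWith f xs ys) ≡ length xs * length ys
length-cartesianProductWith f []       ys = refl
length-cartesianProductWith f (x ∷ xs) ys =
  trans (length-++ (map (f x) ys)) (cong₂ _+_ (length-map (f x) ys) (length-cartesianProductWith f xs ys))

∈-removeAt : ∀ {A : Set} {x y : A} {ys} (x∈ : x ∈ ys) → y ∈ ys → y ≢ x → y ∈ removeAt ys (Any.index x∈)
∈-removeAt (here refl) (here refl) y≢x = contradiction refl y≢x
∈-removeAt (here refl) (there y∈)  y≢x = y∈
∈-removeAt (there x∈)  (here refl) y≢x = here refl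
∈-removeAt (there x∈)  (there y∈)  y≢x = there (∈-removeAt x∈ y∈ y≢x)

Unique-⊆⇒length-≤ : ∀ {A : Set} {xs ys : List A} → Unique xs → (∀ {x} → x ∈ xs → x ∈ ys) → length xs ≤ length ys
Unique-⊆⇒length-≤ [] _ = z≤n
Unique-⊆⇒length-≤ {ys = ys} (x∉xs ∷ u) sub =
  ≤-trans (s≤s (Unique-⊆⇒length-≤ u λ y∈ → ∈-removeAt x∈ (sub (there y∈)) λ y≡x → All.lookup x∉xs y∈ (sym y≡x)))
          (≤-reflexive (sym (length-removeAt′ ys (Any.index x∈))))
  where x∈ = sub (here refl)

∈-allSubsets : ∀ {n} (X : Subset n) → X ∈ allSubsets n
∈-allSubsets []          = here refl
∈-allSubsets (false ∷ X) = ∈-++⁺ˡ (∈-map⁺ _ (∈-allSubsets X))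
∈-allSubsets {suc n} (true ∷ X)  = ∈-++⁺ʳ (map (outside ∷_) (allSubsets n)) (∈-map⁺ _ (∈-allSubsets X))

allSubsets-unique : ∀ n → Unique (allSubsets n)
allSubsets-unique zero    = [] ∷ []
allSubsets-unique (suc n) = Unique.++⁺ (Unique.map⁺ Vec.∷-injectiveʳ (allSubsets-unique n))
  (Unique.map⁺ Vec.∷-injectiveʳ (allSubsets-unique n)) disjoint
  where
  disjoint : ∀ {X} → ¬ (X ∈ map (outside ∷_) (allSubsets n) × X ∈ map (inside ∷_) (allSubsets n))
  disjoint (p , q) with ∈-map⁻ _ p | ∈-map⁻ _ q
  ... | _ , _ , refl | _ , _ , ()

length-allSubsets : ∀ n → length (allSubsets n) ≡ 2 ^ n
length-allSubsets zero    = refl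
length-allSubsets (suc n) = trans (length-++ (map (outside ∷_) (allSubsets n)))
  (cong₂ _+_ (trans (length-map _ (allSubsets n)) (length-allSubsets n))
    (trans (trans (length-map _ (allSubsets n)) (length-allSubsets n)) (sym (+-identityʳ _))))

length-filter-map : ∀ {A B : Set} {P : B → Set} (P? : Decidable P) (f : A → B) xs →
  length (filter P? (map f xs)) ≡ length (filter (P? ∘ f) xs)
length-filter-map P? f []       = refl
length-filter-map P? f (x ∷ xs) with P? (f x)
... | yes _ = cong suc (length-filter-map P? f xs)
... | no  _ = length-filter-map P? f xs

length-filter-allSubsets : ∀ {n} (g : Subset n → Bool) →
  length (filter (λ X → g X ≟ᵇ true) (allSubsets n)) ≡ size g
length-filter-allSubsets {zero}  g with g []
... | true  = refl
... | false = refl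
length-filter-allSubsets {suc n} g = begin
  length (filter P? (A ++ B))                   ≡⟨ cong length (filter-++ P? A B) ⟩
  length (filter P? A ++ filter P? B)           ≡⟨ length-++ (filter P? A) ⟩
  length (filter P? A) + length (filter P? B)   ≡⟨ cong₂ _+_ (half outside) (half inside) ⟩
  size g                                        ∎
  where
  open ≡-Reasoning
  A B : List (Subset (suc n))
  A = map (outside ∷_) (allSubsets n)
  B = map (inside ∷_) (allSubsets n)
  P? : Decidable (λ X → g X ≡ true)
  P? X = g X ≟ᵇ true
  half : ∀ x → length (filter P? (map (x ∷_) (allSubsets n))) ≡ size (g ∘ (x ∷_))
  half x = trans (length-filter-map P? (x ∷_) (allSubsets n)) (length-filter-allSubsets (g ∘ (x ∷_)))

sublist-⊆ : ∀ {A : Set} (L : List A) {F x} → F ∈ sublists L → x ∈ F → x ∈ L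
sublist-⊆ [] (here refl) ()
sublist-⊆ (y ∷ L) F∈ x∈ with ∈-++⁻ (sublists L) F∈
... | inj₁ F∈L = there (sublist-⊆ L F∈L x∈)
... | inj₂ F∈map with ∈-map⁻ _ F∈map
sublist-⊆ (y ∷ L) F∈ (here refl) | inj₂ _ | G , G∈ , refl = here refl
sublist-⊆ (y ∷ L) F∈ (there x∈)  | inj₂ _ | G , G∈ , refl = there (sublist-⊆ L G∈ x∈)

sublists-unique : ∀ {A : Set} {L : List A} → Unique L → Unique (sublists L)
sublists-unique [] = [] ∷ []
sublists-unique {L = x ∷ L} (x∉ ∷ u) =
  Unique.++⁺ (sublists-unique u) (Unique.map⁺ List.∷-injectiveʳ (sublists-unique u)) disjoint
  where
  disjoint : ∀ {F} → ¬ (F ∈ sublists L × F ∈ map (x ∷_) (sublists L))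
  disjoint (p , q) with ∈-map⁻ _ q
  ... | _ , _ , refl = All.lookup x∉ (sublist-⊆ L p (here refl)) refl

-- Families are counted as lists, so decoding must return the very same list. For a sublist of a
-- duplicate-free list, agreement on members is enough.
sublist≡filter : ∀ {A : Set} {P : A → Set} (P? : Decidable P) {L F} → Unique L → F ∈ sublists L →
  (∀ {x} → x ∈ L → P x → x ∈ F) → (∀ {x} → x ∈ F → P x) → F ≡ filter P? L
sublist≡filter P? {[]} _ (here refl) _ _ = refl
sublist≡filter P? {y ∷ L} (y∉ ∷ u) F∈ complete sound with ∈-++⁻ (sublists L) F∈
... | inj₁ F∈L = trans (sublist≡filter P? u F∈L (complete ∘ there) sound)
  (sym (filter-reject P? λ Py → All.lookup y∉ (sublist-⊆ L F∈L (complete (here refl) Py)) refl))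
... | inj₂ F∈map with ∈-map⁻ _ F∈map
...   | G , G∈ , refl = trans (cong (y ∷_) (sublist≡filter P? u G∈ complete′ (sound ∘ there)))
  (sym (filter-accept P? (sound (here refl))))
  where
  complete′ : ∀ {x} → x ∈ L → _ → x ∈ G
  complete′ x∈ Px with complete (there x∈) Px
  ... | here refl = contradiction refl (All.lookup y∉ x∈)
  ... | there x∈G = x∈G

shortSublists : ∀ {A : Set} → ℕ → List A → List (List A)
shortSublists m       []       = [] ∷ []
shortSublists zero    (x ∷ xs) = shortSublists zero xs
shortSublists (suc m) (x ∷ xs) = shortSublists (suc m) xs ++ map (x ∷_) (shortSublists m xs)

filter∈shortSublists : ∀ {A : Set} {P : A → Set} (P? : Decidable P) m xs →
  length (filter P? xs) ≤ m → filter P? xs ∈ shortSublists m xs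
filter∈shortSublists P? m [] le = here refl
filter∈shortSublists P? m (x ∷ xs) le with P? x
filter∈shortSublists P? zero    (x ∷ xs) le | no _ = filter∈shortSublists P? zero xs le
filter∈shortSublists P? (suc m) (x ∷ xs) le | no _ = ∈-++⁺ˡ (filter∈shortSublists P? (suc m) xs le)
filter∈shortSublists P? (suc m) (x ∷ xs) (s≤s le) | yes _ =
  ∈-++⁺ʳ (shortSublists (suc m) xs) (∈-map⁺ (x ∷_) (filter∈shortSublists P? m xs le))

-- Weigh a sublist S of L by Q ^ (|L| − |S|): the weights of all sublists sum to
-- (Q + 1) ^ |L|, and each short sublist weighs at least Q ^ (|L| − m).
length-shortSublists : ∀ {A : Set} Q .{{_ : NonZero Q}} m (xs : List A) →
  length (shortSublists m xs) * Q ^ length xs ≤ Q ^ m * suc Q ^ length xs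
length-shortSublists Q m [] = ≤-trans (m^n>0 Q m) (≤-reflexive (sym (*-identityʳ _)))
length-shortSublists Q zero (x ∷ xs) = begin
  c * (Q * Q ^ ℓ)             ≡⟨ swap c Q (Q ^ ℓ) ⟩
  Q * (c * Q ^ ℓ)             ≤⟨ *-monoʳ-≤ Q (length-shortSublists Q zero xs) ⟩
  Q * (1 * suc Q ^ ℓ)         ≤⟨ m≤n+m _ _ ⟩
  1 * suc Q ^ ℓ + Q * (1 * suc Q ^ ℓ)  ≡⟨ collect Q (suc Q ^ ℓ) ⟩
  1 * (suc Q * suc Q ^ ℓ)     ∎
  where
  open ≤-Reasoning
  ℓ c : ℕ
  ℓ = length xs
  c = length (shortSublists zero xs)
  swap : ∀ a b c → a * (b * c) ≡ b * (a * c)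
  swap = solve-∀
  collect : ∀ Q b → 1 * b + Q * (1 * b) ≡ 1 * (suc Q * b)
  collect = solve-∀
length-shortSublists Q (suc m) (x ∷ xs) = begin
  length (shortSublists (suc m) xs ++ map (x ∷_) (shortSublists m xs)) * (Q * Q ^ ℓ)
    ≡⟨ cong (_* (Q * Q ^ ℓ)) (trans (length-++ (shortSublists (suc m) xs)) (cong (c +_) (length-map _ (shortSublists m xs)))) ⟩
  (c + d) * (Q * Q ^ ℓ)                    ≡⟨ expand c d Q (Q ^ ℓ) ⟩
  Q * (c * Q ^ ℓ + d * Q ^ ℓ)              ≤⟨ *-monoʳ-≤ Q (+-mono-≤ (length-shortSublists Q (suc m) xs) (length-shortSublists Q m xs)) ⟩
  Q * (Q ^ suc m * suc Q ^ ℓ + Q ^ m * suc Q ^ ℓ) ≡⟨ collect Q (Q ^ m) (suc Q ^ ℓ) ⟩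
  Q ^ suc m * (suc Q * suc Q ^ ℓ)          ∎
  where
  open ≤-Reasoning
  ℓ c d : ℕ
  ℓ = length xs
  c = length (shortSublists (suc m) xs)
  d = length (shortSublists m xs)
  expand : ∀ c d Q q → (c + d) * (Q * q) ≡ Q * (c * q + d * q)
  expand = solve-∀
  collect : ∀ Q a b → Q * (Q * a * b + a * b) ≡ Q * a * (suc Q * b)
  collect = solve-∀

vecs : ∀ {A : Set} → List A → ∀ n → List (Vec A n)
vecs as zero    = [] ∷ []
vecs as (suc n) = cartesianProductWith _∷_ as (vecs as n)

length-vecs : ∀ {A : Set} (as : List A) n → length (vecs as n) ≡ length as ^ n
length-vecs as zero    = refl
length-vecs as (suc n) = trans (length-cartesianProductWith _∷_ as (vecs as n)) (cong (length as *_) (length-vecs as n))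

∈-vecs : ∀ {A : Set} {as : List A} → (∀ a → a ∈ as) → ∀ {n} (v : Vec A n) → v ∈ vecs as n
∈-vecs all []      = here refl
∈-vecs all (a ∷ v) = ∈-cartesianProductWith⁺ _∷_ (all a) (∈-vecs all v)

lists≤ : ∀ {A : Set} → List A → ℕ → List (List A)
lists≤ as zero    = [] ∷ []
lists≤ as (suc k) = [] ∷ cartesianProductWith _∷_ as (lists≤ as k)

-- Shorter lists count as words of length k padded with one extra symbol.
length-lists≤ : ∀ {A : Set} (as : List A) k → length (lists≤ as k) ≤ suc (length as) ^ k
length-lists≤ as zero    = ≤-refl
length-lists≤ as (suc k) = +-mono-≤ (m^n>0 (suc (length as)) k)
  (≤-trans (≤-reflexive (length-cartesianProductWith _∷_ as (lists≤ as k))) (*-monoʳ-≤ (length as) (length-lists≤ as k)))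

∈-lists≤ : ∀ {A : Set} {as : List A} → (∀ a → a ∈ as) → ∀ k xs → length xs ≤ k → xs ∈ lists≤ as k
∈-lists≤ all zero    []       le       = here refl
∈-lists≤ all (suc k) []       le       = here refl
∈-lists≤ all (suc k) (x ∷ xs) (s≤s le) = there (∈-cartesianProductWith⁺ _∷_ (all x) (∈-lists≤ all k xs le))

-- Upper bound

Atom : ℕ → Set
Atom n = Subset n × Labelling n

Marked : ∀ {n} → Subset n → Atom n → Set
Marked Y (X , p) = ∃[ a ] ∃[ b ] (Y ≡ flip a (flip b X) × Separated p a b)

marked? : ∀ {n} (Y : Subset n) (A : Atom n) → Dec (Marked Y A)
marked? Y (X , p) = any? λ a → any? λ b → (Y ≟ˢ flip a (flip b X)) ×-dec
  ((lookup p a ≟ᵐ nothing) ⊎-dec ((lookup p b ≟ᵐ nothing) ⊎-dec (lookup p a ≟ᵐ lookup p b)))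
  where _≟ᵐ_ = Maybe.≡-dec _≟ᶠ_

Infeasible : ∀ {n} → List (Atom n) → List (Subset n) → Subset n → Set
Infeasible D R Y = Y ∈ R ⊎ Any (Marked Y) D

infeasible? : ∀ {n} (D : List (Atom n)) R (Y : Subset n) → Dec (Infeasible D R Y)
infeasible? D R Y = (Y ∈? R) ⊎-dec Any.any? (marked? Y) D
  where open DecMembership _≟ˢ_ using (_∈?_)

decode : ∀ {n} → List (Atom n) → List (Subset n) → Family n
decode D R = filter (¬? ∘ infeasible? D R) (allSubsets _)

atoms : ∀ n → List (Atom n)
atoms n = cartesianProduct (allSubsets n) (vecs (nothing ∷ map just (allFin n)) n)

length-atoms : ∀ n → length (atoms n) ≡ 2 ^ n * suc n ^ n
length-atoms n = trans (length-cartesianProductWith _,_ (allSubsets n) _)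
  (cong₂ _*_ (length-allSubsets n)
    (trans (length-vecs (nothing ∷ map just (allFin n)) n)
      (cong (λ k → suc k ^ n) (trans (length-map just (allFin n)) (length-tabulate {n = n} (λ i → i))))))

∈-atoms : ∀ {n} (A : Atom n) → A ∈ atoms n
∈-atoms (X , p) = ∈-cartesianProductWith⁺ _,_ (∈-allSubsets X) (∈-vecs ∈-labels p)
  where
  ∈-labels : ∀ {n} (x : Maybe (Fin n)) → x ∈ (nothing ∷ map just (allFin n))
  ∈-labels nothing  = here refl
  ∈-labels (just i) = there (∈-map⁺ just (∈-allFin i))

codes : ∀ n → ℕ → ℕ → List (Family n)
codes n K m = cartesianProductWith decode (lists≤ (atoms n) K) (shortSublists m (allSubsets n))

module _ {n : ℕ} .{{_ : NonZero n}} (F : Family n) (isEven : IsEvenDeltaMatroid F) (F∈ : F ∈ sublists (allSubsets n)) where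
  open DecMembership (_≟ˢ_ {n}) using (_∈?_)

  private
    φ : Subset n → Bool
    φ X = does (X ∈? F)

    φ⇒∈ : ∀ X → φ X ≡ true → X ∈ F
    φ⇒∈ X eq with X ∈? F
    ... | yes X∈ = X∈

    ∈⇒φ : ∀ {X} → X ∈ F → φ X ≡ true
    ∈⇒φ {X} = dec-true (X ∈? F)

    exchange : ∀ X Y → φ X ≡ true → φ Y ≡ true → ∀ e → e Subset.∈ (X △ Y) →
      ∃[ f ] (f Subset.∈ (X △ Y) × φ (X △ (⁅ e ⁆ ∪ ⁅ f ⁆)) ≡ true)
    exchange X Y φX φY e e∈ =
      let f , f∈ , feasible = All.lookup (All.lookup (proj₂ (proj₁ isEven)) (φ⇒∈ X φX)) (φ⇒∈ Y φY) e e∈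
      in f , f∈ , ∈⇒φ feasible

    parity : ∀ X Y → φ X ≡ true → φ Y ≡ true → odd ∣ X ∣ ≡ odd ∣ Y ∣
    parity X Y φX φY = %2-injective ∣ X ∣ ∣ Y ∣ (All.lookup (All.lookup (proj₂ isEven) (φ⇒∈ X φX)) (φ⇒∈ Y φY))

    edge : Subset n → Fin n → Fin n → Bool
    edge X a b = φ (flip a (flip b X))

    atom : Subset n → Atom n
    atom X = X , Label.label (edge X)

    module Local (X : Subset n) (infeasible : not (φ X) ≡ true) where
      open Neighbourhood φ exchange parity X (not-injective {y = false} infeasible) using (edge-irrefl; edge-sym; nonEdge-trans)
      open Label.Multipartite (edge X) edge-irrefl edge-sym nonEdge-trans public
        using (Separated⇒nonEdge; nonEdge⇒Separated)

    clash : ∀ {Y} → φ Y ≡ true → φ Y ≡ false → ∀ {A : Set} → A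
    clash φY ¬φY = contradiction (trans (sym φY) ¬φY) λ ()

  -- The sets to be covered include those of the wrong parity; around such a centre the graph has no
  -- edges and the same labelling applies. K and m enter only through bounds in product form, which
  -- postpones division to `upper`.
  F∈codes : ∀ {j K m} → 2 * 2 ^ j ≤ n →
    (∀ d → d * (n * n) ≤ j * (8 * 2 ^ n) → d ≤ K) → (∀ r → r * 2 ^ j ≤ 2 ^ n → r ≤ m) → F ∈ codes n K m
  F∈codes {j} {K} {m} 2^j≤n bound-K bound-m with cover j 2^j≤n (not ∘ φ)
  ... | D , R , (D⊆ , R⊆ , covered) , R-small , D-small =
    subst (_∈ codes n K m) (sym F≡decode) (∈-cartesianProductWith⁺ decode
      (∈-lists≤ ∈-atoms K D′ (≤-trans (≤-reflexive (length-map atom D)) (bound-K _ D-small)))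
      (filter∈shortSublists R? m (allSubsets n) (≤-trans (≤-reflexive (length-filter-allSubsets R)) (bound-m _ R-small))))
    where
    R? : ∀ Y → Dec (R Y ≡ true)
    R? Y = R Y ≟ᵇ true
    D′ : List (Atom n)
    D′ = map atom D
    R′ : List (Subset n)
    R′ = filter R? (allSubsets n)
    marks : ∀ {Y} → φ Y ≡ false → ∀ {D} → All (λ X → not (φ X) ≡ true) D → Any (λ X → ∣ X △ Y ∣ ≡ 2) D → Any (Marked Y ∘ atom) D
    marks {Y} ¬φY (X∉ ∷ _) (here {X} eq) =
      let a , b , Y≡ = ∣△∣≡2 X Y eq
      in here (a , b , Y≡ , Local.nonEdge⇒Separated X X∉ (trans (cong φ (sym Y≡)) ¬φY))
    marks ¬φY (_ ∷ D⊆) (there any) = there (marks ¬φY D⊆ any)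
    unmarked : ∀ {Y} → φ Y ≡ true → ∀ {D} → All (λ X → not (φ X) ≡ true) D → ¬ Any (Marked Y ∘ atom) D
    unmarked φY (X∉ ∷ _) (here {X} (a , b , refl , sep)) = clash φY (Local.Separated⇒nonEdge X X∉ sep)
    unmarked φY (_ ∷ D⊆) (there any) = unmarked φY D⊆ any
    complete : ∀ {Y} → Y ∈ allSubsets n → ¬ Infeasible D′ R′ Y → Y ∈ F
    complete {Y} _ ¬inf with φ Y in φY
    ... | true  = φ⇒∈ Y φY
    ... | false with covered Y (cong not φY)
    ...   | inj₁ RY  = contradiction (inj₁ (∈-filter⁺ R? (∈-allSubsets Y) RY)) ¬inf
    ...   | inj₂ any = contradiction (inj₂ (Any.map⁺ (marks φY D⊆ any))) ¬inf
    sound : ∀ {Y} → Y ∈ F → ¬ Infeasible D′ R′ Y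
    sound {Y} Y∈ (inj₁ Y∈R′) = clash (∈⇒φ Y∈) (not-injective {y = false} (R⊆ Y (proj₂ (∈-filter⁻ R? {xs = allSubsets n} Y∈R′))))
    sound Y∈ (inj₂ any) = unmarked (∈⇒φ Y∈) D⊆ (Any.map⁻ any)
    F≡decode : F ≡ decode D′ R′
    F≡decode = sublist≡filter (¬? ∘ infeasible? D′ R′) (allSubsets-unique n) F∈ complete sound

e≤ : ∀ {n} .{{_ : NonZero n}} {j K m} → 2 * 2 ^ j ≤ n →
  (∀ d → d * (n * n) ≤ j * (8 * 2 ^ n) → d ≤ K) → (∀ r → r * 2 ^ j ≤ 2 ^ n → r ≤ m) →
  e n ≤ suc (2 ^ n * suc n ^ n) ^ K * length (shortSublists m (allSubsets n))
e≤ {n} {j} {K} {m} 2^j≤n bound-K bound-m = begin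
  e n ≤⟨ Unique-⊆⇒length-≤ (Unique.filter⁺ isEvenDeltaMatroid? (sublists-unique (allSubsets-unique n))) encode ⟩
  length (codes n K m) ≡⟨ length-cartesianProductWith decode (lists≤ (atoms n) K) _ ⟩
  length (lists≤ (atoms n) K) * length (shortSublists m (allSubsets n))
    ≤⟨ *-monoˡ-≤ _ (length-lists≤ (atoms n) K) ⟩
  suc (length (atoms n)) ^ K * length (shortSublists m (allSubsets n))
    ≡⟨ cong (λ a → suc a ^ K * length (shortSublists m (allSubsets n))) (length-atoms n) ⟩
  suc (2 ^ n * suc n ^ n) ^ K * length (shortSublists m (allSubsets n)) ∎
  where
  open ≤-Reasoning
  encode : ∀ {F} → F ∈ filter isEvenDeltaMatroid? (sublists (allSubsets n)) → F ∈ codes n K m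
  encode {F} F∈ = let F∈sub , isEven = ∈-filter⁻ isEvenDeltaMatroid? {xs = sublists (allSubsets n)} F∈
                  in F∈codes F isEven F∈sub {j} 2^j≤n bound-K bound-m

-- Logarithms and the number of codes

n≤2^⌈log₂n⌉ : ∀ n → n ≤ 2 ^ ⌈log₂ n ⌉
n≤2^⌈log₂n⌉ = <-rec _ step
  where
  open ≤-Reasoning
  step : ∀ n → (∀ {m} → m < n → m ≤ 2 ^ ⌈log₂ m ⌉) → n ≤ 2 ^ ⌈log₂ n ⌉
  step zero          rec = z≤n
  step (suc zero)    rec = s≤s z≤n
  step n@(suc (suc k)) rec = begin
    n                           ≡⟨ ⌊n/2⌋+⌈n/2⌉≡n n ⟨
    ⌊ n /2⌋ + ⌈ n /2⌉           ≤⟨ +-monoˡ-≤ ⌈ n /2⌉ (⌊n/2⌋≤⌈n/2⌉ n) ⟩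
    ⌈ n /2⌉ + ⌈ n /2⌉           ≡⟨ cong (⌈ n /2⌉ +_) (+-identityʳ _) ⟨
    2 * ⌈ n /2⌉                 ≤⟨ *-monoʳ-≤ 2 (rec (⌈n/2⌉<n k)) ⟩
    2 * 2 ^ ⌈log₂ ⌈ n /2⌉ ⌉     ≡⟨ cong (λ l → 2 ^ suc l) (⌈log₂⌈n/2⌉⌉≡⌈log₂n⌉∸1 n) ⟩
    2 ^ suc (⌈log₂ n ⌉ ∸ 1)     ≡⟨ cong (2 ^_) (m+[n∸m]≡n (⌈log₂⌉-mono-≤ {2} {n} (s≤s (s≤s z≤n)))) ⟩
    2 ^ ⌈log₂ n ⌉               ∎

2^[⌈log₂n⌉∸1]≤n : ∀ {n l} → ⌈log₂ n ⌉ ≡ suc l → 2 ^ l ≤ n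
2^[⌈log₂n⌉∸1]≤n {n} {l} eq = ≮⇒≥ λ n<2^l → 1+n≰n (begin
  suc l        ≡⟨ eq ⟨
  ⌈log₂ n ⌉    ≤⟨ ⌈log₂⌉-mono-≤ (<⇒≤ n<2^l) ⟩
  ⌈log₂ 2 ^ l ⌉ ≡⟨ ⌈log₂2^n⌉≡n l ⟩
  l            ∎)
  where open ≤-Reasoning

^-distribʳ-* : ∀ m n o → (m * n) ^ o ≡ m ^ o * n ^ o
^-distribʳ-* m n zero    = refl
^-distribʳ-* m n (suc o) = trans (cong (m * n *_) (^-distribʳ-* m n o)) (swap m n (m ^ o) (n ^ o))
  where
  swap : ∀ a b c d → a * b * (c * d) ≡ a * c * (b * d)
  swap = solve-∀

-- This is (1 - 1 / (Q + 1)) ^ h ≥ 1 - h / (Q + 1), multiplied by (Q + 1) ^ (h + 1).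
Bernoulli : ∀ Q h → suc Q ^ h * suc Q ≤ Q ^ h * suc Q + h * suc Q ^ h
Bernoulli Q zero    = ≤-reflexive (sym (+-identityʳ _))
Bernoulli Q (suc h) = begin
  suc Q * suc Q ^ h * suc Q                       ≡⟨ split Q (suc Q ^ h) ⟩
  Q * (suc Q ^ h * suc Q) + suc Q * suc Q ^ h     ≤⟨ +-monoˡ-≤ _ (*-monoʳ-≤ Q (Bernoulli Q h)) ⟩
  Q * (Q ^ h * suc Q + h * suc Q ^ h) + suc Q * suc Q ^ h ≤⟨ m≤m+n _ (h * suc Q ^ h) ⟩
  Q * (Q ^ h * suc Q + h * suc Q ^ h) + suc Q * suc Q ^ h + h * suc Q ^ h ≡⟨ collect Q h (Q ^ h) (suc Q ^ h) ⟩
  Q * Q ^ h * suc Q + suc h * (suc Q * suc Q ^ h) ∎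
  where
  open ≤-Reasoning
  split : ∀ Q a → suc Q * a * suc Q ≡ Q * (a * suc Q) + suc Q * a
  split = solve-∀
  collect : ∀ Q h a b → Q * (a * suc Q + h * b) + suc Q * b + h * b ≡ Q * a * suc Q + suc h * (suc Q * b)
  collect = solve-∀

[1+Q]^h≤2*Q^h : ∀ Q h → 2 * h ≤ suc Q → suc Q ^ h ≤ 2 * Q ^ h
[1+Q]^h≤2*Q^h Q h 2h≤1+Q = *-cancelʳ-≤ _ _ (suc Q) (+-cancelʳ-≤ (b * suc Q) _ _ (begin
  b * suc Q + b * suc Q               ≡⟨ cong (b * suc Q +_) (+-identityʳ _) ⟨
  2 * (b * suc Q)                     ≤⟨ *-monoʳ-≤ 2 (Bernoulli Q h) ⟩
  2 * (Q ^ h * suc Q + h * b)         ≡⟨ expand (Q ^ h) (suc Q) h b ⟩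
  2 * Q ^ h * suc Q + b * (2 * h)     ≤⟨ +-monoʳ-≤ (2 * Q ^ h * suc Q) (*-monoʳ-≤ b 2h≤1+Q) ⟩
  2 * Q ^ h * suc Q + b * suc Q       ∎))
  where
  open ≤-Reasoning
  b : ℕ
  b = suc Q ^ h
  expand : ∀ a q h b → 2 * (a * q + h * b) ≡ 2 * a * q + b * (2 * h)
  expand = solve-∀

-- The count is at most Q ^ m (1 + 1 / Q) ^ N. Taking Q = 2 ^ (l + 1), which is at least 2 n, makes
-- (1 + 1 / Q) ^ n at most 2, while each listed set still costs only l + 1 bits.
length-shortSublists-allSubsets : ∀ n l m → n ≤ 2 ^ l → m * n ≤ 4 * 2 ^ n →
  length (shortSublists m (allSubsets n)) ^ n ≤ 2 ^ (2 ^ n * (4 * suc l + 1))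
length-shortSublists-allSubsets n l m n≤2^l mn≤4N = begin
  B ^ n                  ≤⟨ *-cancelʳ-≤ _ _ (Q ^ (N * n)) {{m^n≢0 Q (N * n)}} weighted ⟩
  Q ^ (m * n) * 2 ^ N    ≤⟨ *-monoˡ-≤ (2 ^ N) (^-monoʳ-≤ Q mn≤4N) ⟩
  Q ^ (4 * N) * 2 ^ N    ≡⟨ cong (_* 2 ^ N) (^-*-assoc 2 (suc l) (4 * N)) ⟩
  2 ^ (suc l * (4 * N)) * 2 ^ N ≡⟨ ^-distribˡ-+-* 2 (suc l * (4 * N)) N ⟨
  2 ^ (suc l * (4 * N) + N)     ≡⟨ cong (2 ^_) (collect (suc l) N) ⟩
  2 ^ (N * (4 * suc l + 1))     ∎
  where
  open ≤-Reasoning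
  N Q B : ℕ
  N = 2 ^ n
  Q = 2 ^ suc l
  B = length (shortSublists m (allSubsets n))
  instance
    Q≢0 : NonZero Q
    Q≢0 = m^n≢0 2 (suc l)
  collect : ∀ a N → a * (4 * N) + N ≡ N * (4 * a + 1)
  collect = solve-∀
  ^-comm : ∀ a b c → (a ^ b) ^ c ≡ (a ^ c) ^ b
  ^-comm a b c = trans (^-*-assoc a b c) (trans (cong (a ^_) (*-comm b c)) (sym (^-*-assoc a c b)))
  unweighted : B * Q ^ N ≤ Q ^ m * suc Q ^ N
  unweighted = subst (λ ℓ → B * Q ^ ℓ ≤ Q ^ m * suc Q ^ ℓ) (length-allSubsets n) (length-shortSublists Q m (allSubsets n))
  weighted : B ^ n * Q ^ (N * n) ≤ Q ^ (m * n) * 2 ^ N * Q ^ (N * n)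
  weighted = begin
    B ^ n * Q ^ (N * n)                      ≡⟨ cong (B ^ n *_) (^-*-assoc Q N n) ⟨
    B ^ n * (Q ^ N) ^ n                      ≡⟨ ^-distribʳ-* B (Q ^ N) n ⟨
    (B * Q ^ N) ^ n                          ≤⟨ ^-monoˡ-≤ n unweighted ⟩
    (Q ^ m * suc Q ^ N) ^ n                  ≡⟨ ^-distribʳ-* (Q ^ m) (suc Q ^ N) n ⟩
    (Q ^ m) ^ n * (suc Q ^ N) ^ n            ≡⟨ cong₂ _*_ (^-*-assoc Q m n) (^-comm (suc Q) N n) ⟩
    Q ^ (m * n) * (suc Q ^ n) ^ N            ≤⟨ *-monoʳ-≤ (Q ^ (m * n)) (^-monoˡ-≤ N
                                                  ([1+Q]^h≤2*Q^h Q n (≤-trans (*-monoʳ-≤ 2 n≤2^l) (n≤1+n _)))) ⟩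
    Q ^ (m * n) * (2 * Q ^ n) ^ N            ≡⟨ cong (Q ^ (m * n) *_) (^-distribʳ-* 2 (Q ^ n) N) ⟩
    Q ^ (m * n) * (2 ^ N * (Q ^ n) ^ N)      ≡⟨ *-assoc (Q ^ (m * n)) (2 ^ N) _ ⟨
    Q ^ (m * n) * 2 ^ N * (Q ^ n) ^ N        ≡⟨ cong (Q ^ (m * n) * 2 ^ N *_) (trans (^-comm Q n N) (^-*-assoc Q N n)) ⟩
    Q ^ (m * n) * 2 ^ N * Q ^ (N * n)        ∎

-- From n + 1 ≤ 2 ^ (l + 1) the atoms need exponent n + (l + 1) n; the summand 1, the padding symbol
-- of `lists≤`, at most doubles this and is absorbed by a further n.
1+atoms≤ : ∀ n .{{_ : NonZero n}} l → n ≤ 2 ^ l → suc (2 ^ n * suc n ^ n) ≤ 2 ^ (n * (l + 3))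
1+atoms≤ n l n≤2^l = begin
  1 + 2 ^ n * suc n ^ n              ≤⟨ +-mono-≤ (m^n>0 2 (n + suc l * n)) base ⟩
  2 ^ (n + suc l * n) + 2 ^ (n + suc l * n) ≡⟨ cong (2 ^ (n + suc l * n) +_) (+-identityʳ _) ⟨
  2 ^ (1 + (n + suc l * n))          ≤⟨ ^-monoʳ-≤ 2 (+-monoˡ-≤ (n + suc l * n) 1≤n) ⟩
  2 ^ (n + (n + suc l * n))          ≡⟨ cong (2 ^_) (collect n l) ⟩
  2 ^ (n * (l + 3))                  ∎
  where
  open ≤-Reasoning
  1≤n : 1 ≤ n
  1≤n = >-nonZero⁻¹ n
  collect : ∀ n l → n + (n + suc l * n) ≡ n * (l + 3)
  collect = solve-∀
  1+n≤ : suc n ≤ 2 ^ suc l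
  1+n≤ = ≤-trans (+-mono-≤ 1≤n ≤-refl) (≤-trans (+-mono-≤ n≤2^l n≤2^l) (≤-reflexive (cong (2 ^ l +_) (sym (+-identityʳ _)))))
  base : 2 ^ n * suc n ^ n ≤ 2 ^ (n + suc l * n)
  base = begin
    2 ^ n * suc n ^ n          ≤⟨ *-monoʳ-≤ (2 ^ n) (^-monoˡ-≤ n 1+n≤) ⟩
    2 ^ n * (2 ^ suc l) ^ n    ≡⟨ cong (2 ^ n *_) (^-*-assoc 2 (suc l) n) ⟩
    2 ^ n * 2 ^ (suc l * n)    ≡⟨ ^-distribˡ-+-* 2 n (suc l * n) ⟨
    2 ^ (n + suc l * n)        ∎

m*n≤o⇒m≤o/n : ∀ m n o .{{_ : NonZero n}} → m * n ≤ o → m ≤ o / n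
m*n≤o⇒m≤o/n m n o le = ≤-trans (≤-reflexive (sym (m*n/n≡m m n))) (/-monoˡ-≤ n le)

-- With j two below the logarithm, 2 · 2 ^ j ≤ n as `cover` requires, while 2 ^ j ≥ n / 4 leaves at
-- most 4 N / n sets to list.
upper : ∀ n .{{_ : NonZero n}} j → ⌈log₂ n ⌉ ≡ 2 + j → e n ^ n ≤ 2 ^ (2 ^ n * (2 + j) ^ 5)
upper n j logn = begin
  e n ^ n                               ≤⟨ ^-monoˡ-≤ n (e≤ {n} {j} {K} {m} 2*2^j≤n
                                             (λ d → m*n≤o⇒m≤o/n d (n * n) _ {{m*n≢0 n n}}) (λ r → m*n≤o⇒m≤o/n r (2 ^ j) N)) ⟩
  (A ^ K * B) ^ n                       ≡⟨ ^-distribʳ-* (A ^ K) B n ⟩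
  (A ^ K) ^ n * B ^ n                   ≤⟨ *-mono-≤ atomsPart (length-shortSublists-allSubsets n l m n≤2^l mn≤4N) ⟩
  2 ^ (j * (8 * N) * (l + 3)) * 2 ^ (N * (4 * suc l + 1)) ≡⟨ ^-distribˡ-+-* 2 (j * (8 * N) * (l + 3)) _ ⟨
  2 ^ (j * (8 * N) * (l + 3) + N * (4 * suc l + 1)) ≤⟨ ^-monoʳ-≤ 2 exponent ⟩
  2 ^ (N * l ^ 5)                       ∎
  where
  open ≤-Reasoning
  instance
    2^j≢0 : NonZero (2 ^ j)
    2^j≢0 = m^n≢0 2 j
  l N K m A B : ℕ
  l = 2 + j
  N = 2 ^ n
  K = (j * (8 * N) / (n * n)) {{m*n≢0 n n}}
  m = N / 2 ^ j
  A = suc (2 ^ n * suc n ^ n)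
  B = length (shortSublists m (allSubsets n))
  n≤2^l : n ≤ 2 ^ l
  n≤2^l = subst (λ k → n ≤ 2 ^ k) logn (n≤2^⌈log₂n⌉ n)
  2*2^j≤n : 2 * 2 ^ j ≤ n
  2*2^j≤n = 2^[⌈log₂n⌉∸1]≤n logn
  mn≤4N : m * n ≤ 4 * N
  mn≤4N = begin
    m * n              ≤⟨ *-monoʳ-≤ m n≤2^l ⟩
    m * (2 * (2 * 2 ^ j)) ≡⟨ four m (2 ^ j) ⟩
    4 * (m * 2 ^ j)    ≤⟨ *-monoʳ-≤ 4 (m/n*n≤m N (2 ^ j)) ⟩
    4 * N              ∎
    where
    four : ∀ m a → m * (2 * (2 * a)) ≡ 4 * (m * a)
    four = solve-∀
  atomsPart : (A ^ K) ^ n ≤ 2 ^ (j * (8 * N) * (l + 3))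
  atomsPart = begin
    (A ^ K) ^ n                       ≡⟨ ^-*-assoc A K n ⟩
    A ^ (K * n)                       ≤⟨ ^-monoˡ-≤ (K * n) (1+atoms≤ n l n≤2^l) ⟩
    (2 ^ (n * (l + 3))) ^ (K * n)     ≡⟨ ^-*-assoc 2 (n * (l + 3)) (K * n) ⟩
    2 ^ (n * (l + 3) * (K * n))       ≡⟨ cong (2 ^_) (collect n (l + 3) K) ⟩
    2 ^ (K * (n * n) * (l + 3))       ≤⟨ ^-monoʳ-≤ 2 (*-monoˡ-≤ (l + 3) (m/n*n≤m (j * (8 * N)) (n * n) {{m*n≢0 n n}})) ⟩
    2 ^ (j * (8 * N) * (l + 3))       ∎
    where
    collect : ∀ n a K → n * a * (K * n) ≡ K * (n * n) * a
    collect = solve-∀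
  exponent : j * (8 * N) * (l + 3) + N * (4 * suc l + 1) ≤ N * l ^ 5
  -- The exponent is N (8 j² + 44 j + 13). The fifth power of j + 2 is the first to dominate this
  -- coefficient by coefficient, and the added term is the difference.
  exponent = ≤-trans (m≤m+n _ (N * (19 + 36 * j + 72 * (j * j) + 40 * (j * j * j) + 10 * (j * j * j * j) + j * j * j * j * j)))
    (≤-reflexive (polynomial N j))
    where
    polynomial : ∀ N j → j * (8 * N) * ((2 + j) + 3) + N * (4 * (1 + (2 + j)) + 1)
      + N * (19 + 36 * j + 72 * (j * j) + 40 * (j * j * j) + 10 * (j * j * j * j) + j * j * j * j * j)
      ≡ N * ((2 + j) * ((2 + j) * ((2 + j) * ((2 + j) * ((2 + j) * 1)))))
    polynomial = solve-∀

upper-bound : ∀ n → 4 ≤ n → e n ^ n ≤ 2 ^ (2 ^ n * ⌈log₂ n ⌉ ^ 5)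
upper-bound n 4≤n = subst (λ l → e n ^ n ≤ 2 ^ (2 ^ n * l ^ 5)) 2+j≡ (upper n {{>-nonZero (<-≤-trans (s≤s z≤n) 4≤n)}} (⌈log₂ n ⌉ ∸ 2) (sym 2+j≡))
  where
  2+j≡ : 2 + (⌈log₂ n ⌉ ∸ 2) ≡ ⌈log₂ n ⌉
  -- 4 ≤ n makes the logarithm at least 2, so the truncated subtraction is exact.
  2+j≡ = m+[n∸m]≡n (⌈log₂⌉-mono-≤ {4} {n} 4≤n)

-- Lower bound

weight : ∀ {n} → (Fin n → ℕ) → Subset n → ℕ
weight w []      = 0
weight w (x ∷ X) = (if x then w zero else 0) + weight (w ∘ suc) X

weight-⊥ : ∀ {n} (w : Fin n → ℕ) → weight w ⊥ ≡ 0
weight-⊥ {zero}  w = refl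
weight-⊥ {suc n} w = weight-⊥ (w ∘ suc)

weight-insert : ∀ {n} (w : Fin n → ℕ) i X → lookup X i ≡ false → weight w (flip i X) ≡ weight w X + w i
weight-insert w zero    (false ∷ X) _  = +-comm (w zero) _
weight-insert w (suc i) (x ∷ X)     i∉ =
  trans (cong ((if x then w zero else 0) +_) (weight-insert (w ∘ suc) i X i∉)) (sym (+-assoc (if x then w zero else 0) _ _))

weight-delete : ∀ {n} (w : Fin n → ℕ) i X → lookup X i ≡ true → weight w X ≡ weight w (flip i X) + w i
weight-delete w i X i∈ = trans (cong (weight w) (sym (flip-involutive i X)))
  (weight-insert w i (flip i X) (trans (lookup∘updateAt i X) (cong not i∈)))

+-cancel-% : ∀ n .{{_ : NonZero n}} u v {a b} → u % n ≡ v % n → u + a ≡ v + b → a < n → b < n → a ≡ b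
+-cancel-% n u v {a} {b} u≡v u+a≡v+b a<n b<n = begin
  a                        ≡⟨ m<n⇒m%n≡m a<n ⟨
  a % n                    ≡⟨ [m+kn]%n≡m%n a (u / n) n ⟨
  (a + u / n * n) % n      ≡⟨ cong (_% n) (+-cancelˡ-≡ (u % n) _ _ (begin
    u % n + (a + u / n * n)  ≡⟨ swap (u % n) a _ ⟩
    (u % n + u / n * n) + a  ≡⟨ cong (_+ a) (m≡m%n+[m/n]*n u n) ⟨
    u + a                    ≡⟨ u+a≡v+b ⟩
    v + b                    ≡⟨ cong (_+ b) (m≡m%n+[m/n]*n v n) ⟩
    (v % n + v / n * n) + b  ≡⟨ cong (λ r → (r + v / n * n) + b) u≡v ⟨
    (u % n + v / n * n) + b  ≡⟨ swap (u % n) b _ ⟨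
    u % n + (b + v / n * n)  ∎)) ⟩
  (b + v / n * n) % n      ≡⟨ [m+kn]%n≡m%n b (v / n) n ⟩
  b % n                    ≡⟨ m<n⇒m%n≡m b<n ⟩
  b                        ∎
  where
  open ≡-Reasoning
  swap : ∀ r a q → r + (a + q) ≡ (r + q) + a
  swap = solve-∀

residue : ∀ {n} .{{_ : NonZero n}} → Subset n → ℕ
residue {n} X = weight toℕ X % n

-- On the same side of Z both flips change the weight with the same sign, so f and g are congruent
-- modulo n; the weights 0, ..., n - 1 are distinct modulo n.
residue-flip-injective : ∀ {n} .{{_ : NonZero n}} (Z : Subset n) {f g} → lookup Z f ≡ lookup Z g →
  residue (flip f Z) ≡ residue (flip g Z) → f ≡ g
residue-flip-injective {n} Z {f} {g} same eq with lookup Z f in Zf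
... | true  = toℕ-injective (+-cancel-% n (weight toℕ (flip f Z)) (weight toℕ (flip g Z)) eq
                (trans (sym (weight-delete toℕ f Z Zf)) (weight-delete toℕ g Z (sym same))) (toℕ<n f) (toℕ<n g))
-- For insertions the terms are taken crosswise: weight of Z △ g plus f equals weight of Z △ f plus
-- g. This avoids subtraction.
... | false = toℕ-injective (+-cancel-% n (weight toℕ (flip g Z)) (weight toℕ (flip f Z)) (sym eq)
                (trans (cong (_+ toℕ f) (weight-insert toℕ g Z (sym same)))
                  (trans (swap (weight toℕ Z) (toℕ g) (toℕ f)) (cong (_+ toℕ g) (sym (weight-insert toℕ f Z Zf)))))
                (toℕ<n f) (toℕ<n g))
  where
  swap : ∀ a b c → a + b + c ≡ a + c + b
  swap = solve-∀

odd-△ : ∀ {n} (X Y : Subset n) → odd ∣ X △ Y ∣ ≡ odd ∣ X ∣ xor odd ∣ Y ∣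
odd-△ []          []          = refl
odd-△ (true ∷ X)  (true ∷ Y)  = trans (odd-△ X Y) (sym (xor-annihilates-not (odd ∣ X ∣) (odd ∣ Y ∣)))
odd-△ (true ∷ X)  (false ∷ Y) = trans (cong not (odd-△ X Y)) (not-distribˡ-xor (odd ∣ X ∣) (odd ∣ Y ∣))
odd-△ (false ∷ X) (true ∷ Y)  = trans (cong not (odd-△ X Y)) (not-distribʳ-xor (odd ∣ X ∣) (odd ∣ Y ∣))
odd-△ (false ∷ X) (false ∷ Y) = odd-△ X Y

∣∣≡suc⇒nonempty : ∀ {n} (X : Subset n) {k} → ∣ X ∣ ≡ suc k → ∃[ i ] lookup X i ≡ true
∣∣≡suc⇒nonempty (true ∷ X)  _  = zero , refl
∣∣≡suc⇒nonempty (false ∷ X) eq = let i , i∈ = ∣∣≡suc⇒nonempty X eq in suc i , i∈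

odd⇒nonempty : ∀ {n} (X : Subset n) → odd ∣ X ∣ ≡ true → ∃[ i ] lookup X i ≡ true
odd⇒nonempty X o with ∣ X ∣ in eq
... | suc k = ∣∣≡suc⇒nonempty X eq

∈-delete : ∀ {n} {i j} (X : Subset n) → lookup X i ≡ true → lookup (flip i X) j ≡ true → j ≢ i × lookup X j ≡ true
∈-delete {i = i} {j} X i∈ j∈ = j≢i , trans (sym (lookup∘updateAt′ j i j≢i X)) j∈
  where
  j≢i : j ≢ i
  j≢i refl = contradiction (trans (sym j∈) (trans (lookup∘updateAt i X) (cong not i∈))) λ ()

-- Deleting from the even sets some of those with residue k: of three sets
-- Z △ f₁, Z △ f₂, Z △ f₃ at least one has a residue other than k, since two of the
-- fᵢ lie both inside or both outside Z.
module Sparse {n : ℕ} .{{_ : NonZero n}} (k : ℕ) (F : Family n)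
  (even : ∀ {X} → X ∈ F → odd ∣ X ∣ ≡ false)
  (full : ∀ {X} → odd ∣ X ∣ ≡ false → residue X ≢ k → X ∈ F) where

  exchange : ∀ {X Y} → X ∈ F → Y ∈ F → ∀ e → e Subset.∈ (X △ Y) →
    ∃[ f ] (f Subset.∈ (X △ Y) × (X △ (⁅ e ⁆ ∪ ⁅ f ⁆)) ∈ F)
  exchange {X} {Y} X∈ Y∈ e e∈ with odd⇒nonempty (flip e (X △ Y)) T₁-odd
    where
    T₁-odd : odd ∣ flip e (X △ Y) ∣ ≡ true
    T₁-odd = trans (odd-flip e (X △ Y)) (cong not (trans (odd-△ X Y) (cong₂ _xor_ (even X∈) (even Y∈))))
  ... | f₁ , f₁∈T₁ = search ∣ T₂ ∣ refl
    where
    T₀ T₁ T₂ Z : Subset n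
    T₀ = X △ Y
    T₁ = flip e T₀
    T₂ = flip f₁ T₁
    Z = flip e X
    Result : Set
    Result = ∃[ f ] (f Subset.∈ T₀ × (X △ (⁅ e ⁆ ∪ ⁅ f ⁆)) ∈ F)
    eT : lookup T₀ e ≡ true
    eT = []=⇒lookup e∈
    T₂-even : odd ∣ T₂ ∣ ≡ false
    T₂-even = trans (odd-flip f₁ T₁) (cong not (trans (odd-flip e T₀)
      (cong not (trans (odd-△ X Y) (cong₂ _xor_ (even X∈) (even Y∈))))))
    witness : ∀ {f} → lookup T₁ f ≡ true → flip f Z ∈ F → Result
    witness {f} f∈T₁ W∈ = let f≢e , f∈T₀ = ∈-delete T₀ eT f∈T₁ in
      f , lookup⇒[]= f T₀ f∈T₀ , subst (_∈ F) (sym (trans (△-⁅⁆∪⁅⁆ X (≢-sym f≢e)) (flip-comm e f X))) W∈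
    flip-even : ∀ f → odd ∣ flip f Z ∣ ≡ false
    flip-even f = trans (odd-flip f Z) (cong not (trans (odd-flip e X) (cong not (even X∈))))
    T₂≡ : flip f₁ Z △ Y ≡ T₂
    T₂≡ = trans (flip-△ f₁ Z Y) (cong (flip f₁) (flip-△ e X Y))
    -- T₁ = (X △ Y) - e has odd size. If f₁ is its only element, the exchange lands on Y itself.
    -- Otherwise T₂ = T₁ - f₁ has positive even size and yields the two further candidates f₂ and
    -- f₃.
    search : ∀ s → ∣ T₂ ∣ ≡ s → Result
    search zero    eq = witness f₁∈T₁ (subst (_∈ F) (sym (∣△∣≡0 (flip f₁ Z) Y (trans (cong ∣_∣ T₂≡) eq))) Y∈)
    search (suc s) eq with ∣∣≡suc⇒nonempty T₂ eq
    ... | f₂ , f₂∈T₂ with odd⇒nonempty (flip f₂ T₂) (trans (odd-flip f₂ T₂) (cong not T₂-even))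
    ...   | f₃ , f₃∈T₃ with ∈-delete T₂ f₂∈T₂ f₃∈T₃
    ...     | f₃≢f₂ , f₃∈T₂ with ∈-delete T₁ f₁∈T₁ f₂∈T₂ | ∈-delete T₁ f₁∈T₁ f₃∈T₂
    ...       | f₂≢f₁ , f₂∈T₁ | f₃≢f₁ , f₃∈T₁
      with residue (flip f₁ Z) ≟ k | residue (flip f₂ Z) ≟ k | residue (flip f₃ Z) ≟ k
    ... | no r₁ | _ | _ = witness f₁∈T₁ (full (flip-even f₁) r₁)
    ... | _ | no r₂ | _ = witness f₂∈T₁ (full (flip-even f₂) r₂)
    ... | _ | _ | no r₃ = witness f₃∈T₁ (full (flip-even f₃) r₃)
    ... | yes r₁ | yes r₂ | yes r₃ = ⊥-elim (pigeonhole (lookup Z f₁) (lookup Z f₂) (lookup Z f₃) refl refl refl)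
      where
      distinct : ∀ {f g b} → f ≢ g → residue (flip f Z) ≡ k → residue (flip g Z) ≡ k → lookup Z f ≡ b → lookup Z g ≢ b
      distinct f≢g rf rg Zf Zg = f≢g (residue-flip-injective Z (trans Zf (sym Zg)) (trans rf (sym rg)))
      pigeonhole : ∀ a b c → lookup Z f₁ ≡ a → lookup Z f₂ ≡ b → lookup Z f₃ ≢ c
      pigeonhole true  true  _     a b _ = distinct f₂≢f₁ r₂ r₁ b a
      pigeonhole false false _     a b _ = distinct f₂≢f₁ r₂ r₁ b a
      pigeonhole true  _     true  a _ c = distinct f₃≢f₁ r₃ r₁ c a
      pigeonhole false _     false a _ c = distinct f₃≢f₁ r₃ r₁ c a
      pigeonhole _     true  true  _ b c = distinct f₃≢f₂ r₃ r₂ c b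
      pigeonhole _     false false _ b c = distinct f₃≢f₂ r₃ r₂ c b

  sameParity : AllSameParity F
  sameParity = All.tabulate λ {X} X∈ → All.tabulate λ {Y} Y∈ → trans (zero%2 X (even X∈)) (sym (zero%2 Y (even Y∈)))
    where
    zero%2 : ∀ (X : Subset n) → odd ∣ X ∣ ≡ false → ∣ X ∣ % 2 ≡ 0
    zero%2 X eq = trans (%2≡odd ∣ X ∣) (cong (λ b → if b then 1 else 0) eq)

  isEvenDeltaMatroid : ∀ {X} → odd ∣ X ∣ ≡ false → residue X ≢ k → IsEvenDeltaMatroid F
  isEvenDeltaMatroid {X} X-even X∉k =
    (nonEmpty (full {X} X-even X∉k) , All.tabulate λ X∈ → All.tabulate λ Y∈ → exchange X∈ Y∈) , sameParity
    where
    nonEmpty : ∀ {X} → X ∈ F → F ≢ []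
    nonEmpty () refl

-- The empty set has residue 0 and {0, 1} has residue 1, so one of them is never deleted and the
-- family is non-empty. This takes a ground set of at least two elements.
two-residues : ∀ m k → ∃[ X ] (odd ∣ X ∣ ≡ false × residue {2 + m} X ≢ k)
two-residues m (suc k) = ⊥ , cong odd (∣⊥∣≡0 (2 + m)) , λ eq → 0≢1+n (trans (sym (cong (_% (2 + m)) (weight-⊥ {2 + m} toℕ))) eq)
two-residues m zero = true ∷ true ∷ ⊥ , cong (λ c → odd (2 + c)) (∣⊥∣≡0 m) ,
  λ eq → 1+n≢0 (trans (sym (cong (λ w → suc w % (2 + m)) (weight-⊥ {m} (λ i → 2 + toℕ i)))) eq)

-- Counting families with prescribed and free members

data Role : Set where
  excluded free forced : Role

isFree : Role → Bool
isFree free = true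
isFree _    = false

-- Each free element may be taken or left independently. The induction varies P: taking x replaces
-- it by the predicate on lists with x in front.
length-filter-sublists : ∀ {A : Set} {P : List A → Set} (P? : Decidable P) (role : A → Role) (L : List A) →
  (∀ F → (∀ {x} → x ∈ F → role x ≢ excluded) → (∀ {x} → x ∈ L → role x ≡ forced → x ∈ F) → P F) →
  2 ^ length (filter (λ x → isFree (role x) ≟ᵇ true) L) ≤ length (filter P? (sublists L))
length-filter-sublists P? role [] allP with P? []
... | yes _ = ≤-refl
... | no ¬P = contradiction (allP [] (λ ()) λ ()) ¬P
length-filter-sublists {P = P} P? role (x ∷ L) allP = ≤-trans bound (≤-reflexive (sym split))
  where
  split : length (filter P? (sublists L ++ map (x ∷_) (sublists L)))
        ≡ length (filter P? (sublists L)) + length (filter (P? ∘ (x ∷_)) (sublists L))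
  split = trans (cong length (filter-++ P? (sublists L) _))
    (trans (length-++ (filter P? (sublists L))) (cong (_ +_) (length-filter-map P? (x ∷_) (sublists L))))
  without : role x ≢ forced →
    2 ^ length (filter (λ x → isFree (role x) ≟ᵇ true) L) ≤ length (filter P? (sublists L))
  without ¬forced = length-filter-sublists P? role L λ F ok all → allP F ok λ where
    (here refl) isForced → contradiction isForced ¬forced
    (there y∈)  isForced → all y∈ isForced
  within : role x ≢ excluded →
    2 ^ length (filter (λ x → isFree (role x) ≟ᵇ true) L) ≤ length (filter (P? ∘ (x ∷_)) (sublists L))
  within ¬excluded = length-filter-sublists (P? ∘ (x ∷_)) role L λ F ok all → allP (x ∷ F)
    (λ where
      (here refl) → ¬excluded
      (there y∈)  → ok y∈)
    (λ where
      (here refl) _ → here refl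
      (there y∈)  isForced → there (all y∈ isForced))
  bound : 2 ^ length (filter (λ x → isFree (role x) ≟ᵇ true) (x ∷ L))
        ≤ length (filter P? (sublists L)) + length (filter (P? ∘ (x ∷_)) (sublists L))
  bound with role x in eq
  ... | excluded = ≤-trans (without (λ r → contradiction (trans (sym eq) r) λ ())) (m≤m+n _ _)
  ... | forced   = ≤-trans (within (λ r → contradiction (trans (sym eq) r) λ ())) (m≤n+m _ _)
  ... | free     = +-mono-≤ (without (λ r → contradiction (trans (sym eq) r) λ ()))
                     (≤-trans (≤-reflexive (+-identityʳ _)) (within (λ r → contradiction (trans (sym eq) r) λ ())))

residueClass : ∀ {n} .{{_ : NonZero n}} → ℕ → Subset n → Bool
residueClass k X = not (odd ∣ X ∣) ∧ (residue X ≡ᵇ k)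

role : ∀ {n} .{{_ : NonZero n}} → ℕ → Subset n → Role
role k X = if odd ∣ X ∣ then excluded else (if residue X ≡ᵇ k then free else forced)

2^size≤e : ∀ m k → 2 ^ size (residueClass {2 + m} k) ≤ e (2 + m)
2^size≤e m k = begin
  2 ^ size {n} (residueClass k)                ≡⟨ cong (2 ^_) (cubeSum-cong {n} (λ X → cong ⟦_⟧ (free≡ X))) ⟨
  2 ^ size {n} (isFree ∘ role k)               ≡⟨ cong (2 ^_) (length-filter-allSubsets {n} (isFree ∘ role k)) ⟨
  2 ^ length (filter (λ X → isFree (role k X) ≟ᵇ true) (allSubsets n)) ≤⟨ length-filter-sublists isEvenDeltaMatroid? (role k) (allSubsets n) valid ⟩
  e n                                      ∎
  where
  open ≤-Reasoning
  n : ℕ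
  n = 2 + m
  free≡ : ∀ (X : Subset n) → isFree (role k X) ≡ residueClass k X
  free≡ X with odd ∣ X ∣ | residue X ≡ᵇ k
  ... | true  | _     = refl
  ... | false | true  = refl
  ... | false | false = refl
  valid : ∀ F → (∀ {X} → X ∈ F → role k X ≢ excluded) → (∀ {X} → X ∈ allSubsets n → role k X ≡ forced → X ∈ F) → IsEvenDeltaMatroid F
  valid F ok all = let X , X-even , X∉k = two-residues m k in Sparse.isEvenDeltaMatroid k F even full {X} X-even X∉k
    where
    even : ∀ {X} → X ∈ F → odd ∣ X ∣ ≡ false
    even {X} X∈ with odd ∣ X ∣ | ok X∈
    ... | true  | ¬excluded = contradiction refl ¬excluded
    ... | false | _         = refl
    full : ∀ {X} → odd ∣ X ∣ ≡ false → residue X ≢ k → X ∈ F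
    full {X} X-even X∉k = all (∈-allSubsets X) forced≡
      where
      forced≡ : role k X ≡ forced
      forced≡ rewrite X-even with residue X ≡ᵇ k in eq
      ... | true  = contradiction (≡ᵇ⇒≡ _ k (subst T (sym eq) _)) X∉k
      ... | false = refl

-- A residue class of at least average size

cubeSum-sum-comm : ∀ {n m} (h : Fin m → Subset n → ℕ) →
  sum (λ k → cubeSum (h k)) ≡ cubeSum (λ X → sum (λ k → h k X))
cubeSum-sum-comm {zero}  h = refl
cubeSum-sum-comm {suc n} h = trans (∑-distrib-+ (λ k → cubeSum (h k ∘ (false ∷_))) _)
  (cong₂ _+_ (cubeSum-sum-comm (λ k → h k ∘ (false ∷_))) (cubeSum-sum-comm (λ k → h k ∘ (true ∷_))))

sum-indicator : ∀ b {n} r → r < n → sum {n} (λ k → ⟦ b ∧ (r ≡ᵇ toℕ k) ⟧) ≡ ⟦ b ⟧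
sum-indicator false {n}     r       _         = sum-replicate-zero n
sum-indicator true  {suc n} zero    _         = cong suc (sum-replicate-zero n)
sum-indicator true  {suc n} (suc r) (s≤s r<n) = sum-indicator true r r<n

-- Toggling the first element pairs every even set with an odd one.
size-even : ∀ n → size {suc n} (λ X → not (odd ∣ X ∣)) ≡ 2 ^ n
size-even n = trans (sym (cubeSum-distrib-+ {n} (λ X → ⟦ not (odd ∣ X ∣) ⟧) (λ X → ⟦ not (not (odd ∣ X ∣)) ⟧)))
  (trans (cubeSum-cong {n} (λ X → complementary (odd ∣ X ∣))) (cubeSum-1 n))
  where
  complementary : ∀ b → ⟦ not b ⟧ + ⟦ not (not b) ⟧ ≡ 1
  complementary true  = refl
  complementary false = refl

sum-residueClasses : ∀ n → sum {suc n} (λ k → size (residueClass {suc n} (toℕ k))) ≡ 2 ^ n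
sum-residueClasses n = trans (cubeSum-sum-comm {suc n} {suc n} (λ k X → ⟦ residueClass (toℕ k) X ⟧))
  (trans (cubeSum-cong {suc n} {g = λ X → sum {suc n} (λ k → ⟦ residueClass (toℕ k) X ⟧)} (λ X → sum-indicator (not (odd ∣ X ∣)) {suc n} (residue X) (m%n<n (weight toℕ X) (suc n)))) (size-even n))

sum≤n*max : ∀ {n} (c : Fin (suc n) → ℕ) → ∃[ k ] sum c ≤ suc n * c k
sum≤n*max {zero}  c = zero , ≤-refl
sum≤n*max {suc n} c with sum≤n*max (c ∘ suc)
... | k , le with ≤-total (c zero) (c (suc k))
...   | inj₁ c₀≤ = suc k , +-mono-≤ c₀≤ le
...   | inj₂ ≤c₀ = zero , +-monoʳ-≤ (c zero) (≤-trans le (*-monoʳ-≤ (suc n) ≤c₀))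

lower-bound : ∀ n → 1 ≤ n → 2 ^ (2 ^ (n ∸ 1)) ≤ e n ^ n
-- On one element all residues coincide, so the construction fails; here `e 1` evaluates to 2, the
-- two families with a single feasible set.
lower-bound (suc zero)    _ = ≤-refl
lower-bound (suc (suc m)) _ = begin
  2 ^ (2 ^ (1 + m))               ≡⟨ cong (2 ^_) {x = sum {2 + m} class} (sum-residueClasses (1 + m)) ⟨
  2 ^ sum {2 + m} class                   ≤⟨ ^-monoʳ-≤ 2 (proj₂ (sum≤n*max class)) ⟩
  2 ^ ((2 + m) * class k)         ≡⟨ cong (2 ^_) (*-comm (2 + m) (class k)) ⟩
  2 ^ (class k * (2 + m))         ≡⟨ ^-*-assoc 2 (class k) (2 + m) ⟨
  (2 ^ class k) ^ (2 + m)         ≤⟨ ^-monoˡ-≤ (2 + m) (2^size≤e m (toℕ k)) ⟩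
  e (2 + m) ^ (2 + m)             ∎
  where
  open ≤-Reasoning
  class : Fin (2 + m) → ℕ
  class k = size (residueClass {2 + m} (toℕ k))
  k : Fin (2 + m)
  k = proj₁ (sum≤n*max class)

theorem3 : ((n : ℕ) → 1 ≤ n → 2 ^ (2 ^ (n ∸ 1)) ≤ e n ^ n)
    × (∃[ C ] ∃[ N ] ((n : ℕ) → N ≤ n → e n ^ n ≤ 2 ^ (2 ^ n * ⌈log₂ n ⌉ ^ C)))
theorem3 = lower-bound , 5 , 4 , upper-bound
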